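{- Let $\Gamma$ be an edge-weighted graph obtained from a cycle $Z$ (on at least $3$ vertices) with all edge weights $1$ by adjoining a new vertex $k$ joined to a positive even number of vertices of $Z$ by edges of weights $1$ or $2$. Then $\Gamma$ is not positive, except in the single case where $k$ is joined to exactly two adjacent vertices of $Z$ and both of these edges have weight $1$.
   Context: An edge-weighted graph is a finite simple graph with a positive integer weight on each edge. A quasi-Cartan matrix is a square integer matrix $A$ with diagonal entries $2$ such that $DA$ is symmetric for some diagonal $D$ with positive diagonal entries; it is positive if $DA$ is positive definite. Its diagram $\Gamma(A)$ has vertices the indices, an edge $\{i,j\}$ for each $i\ne j$ with $A_{ij}\ne0$, of weight $A_{ij}A_{ji}$ and sign $-\operatorname{sgn}(A_{ij})$. An edge-weighted graph is positive if some assignment of signs to its edges makes it the diagram of a positive quasi-Cartan matrix. -}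

module Defs where

open import Data.Bool using (Bool; true; false; _∨_; _∧_; if_then_else_; T)
open import Data.Bool.Properties using (∨-comm; ∧-zeroʳ)
open import Data.Nat as ℕ using (ℕ; zero; suc; _≤_; _<_; s≤s; z≤n)
open import Data.Nat using () renaming (_≡ᵇ_ to _=ℕ_)
open import Data.Fin using (Fin; zero; suc; toℕ)
open import Data.Integer as ℤ using (ℤ; +_; sign)
open import Data.Sign using (Sign; opposite)
open import Data.Rational as ℚ using (ℚ; 0ℚ)
open import Data.Product using (Σ; ∃; _×_; _,_)
open import Relation.Binary.PropositionalEquality using (_≡_; _≢_; refl; cong)

------------------------------------------------------------------------
-- Finite sums over Fin n

∑ℚ : ∀ {n} → (Fin n → ℚ) → ℚ
∑ℚ {zero}  f = 0ℚ
∑ℚ {suc n} f = f zero ℚ.+ ∑ℚ (λ i → f (suc i))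

∑ℕ : ∀ {n} → (Fin n → ℕ) → ℕ
∑ℕ {zero}  f = 0
∑ℕ {suc n} f = f zero ℕ.+ ∑ℕ (λ i → f (suc i))

-- the integer z viewed as a rational number
ℤ→ℚ : ℤ → ℚ
ℤ→ℚ z = z ℚ./ 1

------------------------------------------------------------------------
-- Edge-weighted graphs on the vertex set Fin n.
-- weight i j = 0 means "no edge"; a positive value is the edge weight.
-- Symmetric and zero on the diagonal: a finite simple graph with
-- positive integer weights on its edges.

record EdgeWeightedGraph (n : ℕ) : Set where
  field
    weight : Fin n → Fin n → ℕ
    sym    : ∀ i j → weight i j ≡ weight j i
    irrefl : ∀ i → weight i i ≡ 0

open EdgeWeightedGraph public

------------------------------------------------------------------------
-- Quasi-Cartan matrices

Matrix : ℕ → Set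
Matrix n = Fin n → Fin n → ℤ

-- D A symmetric for the diagonal matrix D = diag d
IsSymmetrizer : ∀ {n} → Matrix n → (Fin n → ℚ) → Set
IsSymmetrizer A d =
  (∀ i → 0ℚ ℚ.< d i) × (∀ i j → d i ℚ.* ℤ→ℚ (A i j) ≡ d j ℚ.* ℤ→ℚ (A j i))

IsQuasiCartan : ∀ {n} → Matrix n → Set
IsQuasiCartan A = (∀ i → A i i ≡ + 2) × ∃ (IsSymmetrizer A)

-- positive definiteness of a (rational) square matrix B
PositiveDefinite : ∀ {n} → (Fin n → Fin n → ℚ) → Set
PositiveDefinite {n} B =
  ∀ (x : Fin n → ℚ) → (∃ λ i → x i ≢ 0ℚ) →
    0ℚ ℚ.< ∑ℚ (λ i → ∑ℚ (λ j → x i ℚ.* B i j ℚ.* x j))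

-- A is positive: DA is positive definite for some symmetrizer D
IsPositiveQuasiCartan : ∀ {n} → Matrix n → Set
IsPositiveQuasiCartan A =
  (∀ i → A i i ≡ + 2) ×
  ∃ λ d → IsSymmetrizer A d ×
          PositiveDefinite (λ i j → d i ℚ.* ℤ→ℚ (A i j))

------------------------------------------------------------------------
-- Diagrams.  A sign assignment gives a sign to each (ordered pair of
-- vertices forming an) edge.  A is a matrix whose diagram Γ(A) is the
-- graph G with signs s: for i ≠ j, {i,j} is an edge of G iff A i j ≠ 0,
-- and then its weight is A i j * A j i and its sign is -sgn(A i j).

SignAssignment : ℕ → Set
SignAssignment n = Fin n → Fin n → Sign

IsDiagramOf : ∀ {n} → Matrix n → EdgeWeightedGraph n → SignAssignment n → Set
IsDiagramOf A G s =
  ∀ i j → i ≢ j →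
    (A i j ≡ + 0 → weight G i j ≡ 0) ×
    (A i j ≢ + 0 → (weight G i j ≢ 0) ×
                   (+ weight G i j ≡ A i j ℤ.* A j i) ×
                   (s i j ≡ opposite (sign (A i j))))

Positive : ∀ {n} → EdgeWeightedGraph n → Set
Positive {n} G =
  ∃ λ (s : SignAssignment n) → ∃ λ (A : Matrix n) →
    IsPositiveQuasiCartan A × IsDiagramOf A G s

------------------------------------------------------------------------
-- The cycle Z on vertices Fin m: i ~ i+1 (mod m).

stepᵇ : (m : ℕ) → Fin m → Fin m → Bool
stepᵇ m i j = (suc (toℕ i) =ℕ toℕ j) ∨ ((suc (toℕ i) =ℕ m) ∧ (toℕ j =ℕ 0))

adjᵇ : (m : ℕ) → Fin m → Fin m → Bool
adjᵇ m i j = stepᵇ m i j ∨ stepᵇ m j i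

-- adjacency in the cycle Z
Adjacent : (m : ℕ) → Fin m → Fin m → Set
Adjacent m i j = T (adjᵇ m i j)

cycleWeight : (m : ℕ) → Fin m → Fin m → ℕ
cycleWeight m i j = if adjᵇ m i j then 1 else 0

private
  suc≢ : ∀ x → (suc x =ℕ x) ≡ false
  suc≢ zero    = refl
  suc≢ (suc x) = suc≢ x

  stepIrr : ∀ m → 3 ≤ m → (i : Fin m) → stepᵇ m i i ≡ false
  stepIrr (suc (suc (suc m))) _ zero    = refl
  stepIrr (suc zero) (s≤s ()) zero
  stepIrr (suc (suc zero)) (s≤s (s≤s ())) zero
  stepIrr (suc m)             _ (suc i) rewrite suc≢ (suc (toℕ i)) | ∧-zeroʳ (suc (toℕ i) =ℕ m) = refl

  cycleIrr : ∀ m → 3 ≤ m → (i : Fin m) → cycleWeight m i i ≡ 0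
  cycleIrr m h i rewrite stepIrr m h i = refl

  cycleSym : ∀ m (i j : Fin m) → cycleWeight m i j ≡ cycleWeight m j i
  cycleSym m i j rewrite ∨-comm (stepᵇ m i j) (stepᵇ m j i) = refl

-- Γ: the cycle Z on the vertices suc i (i : Fin m), all weights 1,
-- with a new vertex k = zero joined to suc i by an edge of weight c i
-- (c i = 0 meaning no edge).
Γ-weight : (m : ℕ) → (Fin m → ℕ) → Fin (suc m) → Fin (suc m) → ℕ
Γ-weight m c zero    zero    = 0
Γ-weight m c zero    (suc j) = c j
Γ-weight m c (suc i) zero    = c i
Γ-weight m c (suc i) (suc j) = cycleWeight m i j

Γ : (m : ℕ) → 3 ≤ m → (Fin m → ℕ) → EdgeWeightedGraph (suc m)
Γ m h c = record { weight = Γ-weight m c ; sym = sy ; irrefl = ir }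
  where
  sy : ∀ i j → Γ-weight m c i j ≡ Γ-weight m c j i
  sy zero    zero    = refl
  sy zero    (suc j) = refl
  sy (suc i) zero    = refl
  sy (suc i) (suc j) = cycleSym m i j
  ir : ∀ i → Γ-weight m c i i ≡ 0
  ir zero    = refl
  ir (suc i) = cycleIrr m h i

-- number of vertices of Z joined to k
degreeK : (m : ℕ) → (Fin m → ℕ) → ℕ
degreeK m c = ∑ℕ (λ i → if c i =ℕ 0 then 0 else 1)

-- the exceptional case: k joined to exactly two adjacent vertices i, j
-- of Z, both edges of weight 1
Exceptional : (m : ℕ) → (Fin m → ℕ) → Set
Exceptional m c =
  ∃ λ i → ∃ λ j → Adjacent m i j × c i ≡ 1 × c j ≡ 1 ×
    (∀ l → l ≢ i → l ≢ j → c l ≡ 0)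

{-# OPTIONS --safe #-}
-- Suppose A is a positive quasi-Cartan matrix with diagram Γ and symmetriser d. All cycle
-- edges have weight 1, so the entries of A along the cycle are units ±1 and d is constant
-- (= δ) on the cycle. Starting from τ 0 = 1, set τ (t + 1) = −A(t, t+1) τ t. If this rule
-- also holds across the closing edge n → 0, then τ (extended by 0 at k) is an isotropic
-- vector, since every cycle row contributes 2 − 1 − 1 = 0. Otherwise, attach to each
-- neighbour t of k the sign σ t of A(t, k) τ t. As k has an even number of neighbours, either
-- two consecutive neighbours p < q carry equal signs, or the first and the last neighbour
-- carry opposite signs; in the second case the arc from the last neighbour across n → 0 to
-- the first one has compatible signs once τ is negated below the closing edge. Take ±τ on
-- such an arc, 0 elsewhere on the cycle, and −A(k, p) x p at k: the form then equals
-- 2δ(w − N), where N = A(q, k) x q · A(k, p) x p is positive with N² = c p · c q, and w = 1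
-- unless the arc is the whole cycle, where w = 2. Positivity forces N < w, which leaves only
-- the whole cycle with c p = c q = 1: the exceptional configuration.
module Submission where

open import Defs hiding (sym)
open import Data.Nat as ℕ using (ℕ; zero; suc; _≤_; _<_; s≤s; z≤n; _≡ᵇ_)
import Data.Nat.Properties as ℕP
open import Data.Nat.DivMod using (_mod_; m<n⇒m%n≡m)
open import Data.Fin using (Fin; zero; suc; toℕ)
import Data.Fin.Properties as FinP
open import Data.Integer as ℤ
  using (ℤ; +_; -[1+_]; +[1+_]; -_; _+_; _-_; _*_; ∣_∣; sign; 0ℤ; 1ℤ; -1ℤ)
import Data.Integer.Properties as ℤP
open import Data.Integer.Tactic.RingSolver using (solve-∀)
open import Data.Rational as ℚ using (ℚ; 0ℚ; 1ℚ)
open import Data.Rational.Literals using (fromℤ)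
import Data.Rational.Properties as ℚP
open import Data.Rational.Solver using (module +-*-Solver)
import Data.Rational.Unnormalised as ℚᵘ
import Data.Rational.Unnormalised.Properties as ℚᵘP
open import Data.Sign as Sign using (Sign; opposite)
import Data.Sign.Properties as SignP
open import Data.Bool using (Bool; true; false; T; _∨_; _∧_; if_then_else_)
open import Data.Bool.Properties using (T-≡; T-∨; T-∧)
open import Data.List using (List; []; _∷_; foldr; map)
open import Data.List.Relation.Unary.All using (All; []; _∷_)
open import Data.List.Relation.Unary.AllPairs using (AllPairs; []; _∷_)
open import Data.Vec.Functional using (updateAt)
open import Data.Vec.Functional.Properties using (updateAt-updates; updateAt-minimal)
open import Data.Sum using (_⊎_; inj₁; inj₂)
open import Data.Product using (_×_; _,_; ∃; proj₁; proj₂)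
open import Data.Empty using (⊥; ⊥-elim)
open import Function using (_∘_; const; _⇔_; Equivalence)
open import Relation.Nullary using (¬_; yes; no; contradiction)
open import Relation.Nullary.Decidable using (dec-true; dec-false)
open import Relation.Binary.Definitions using (tri<; tri≈; tri>)
open import Relation.Binary.PropositionalEquality

-- Units and signs in ℤ

∣i∣≡1⇒i≡±1 : ∀ i → ∣ i ∣ ≡ 1 → i ≡ 1ℤ ⊎ i ≡ -1ℤ
∣i∣≡1⇒i≡±1 (+ .1)    refl = inj₁ refl
∣i∣≡1⇒i≡±1 -[1+ .0 ] refl = inj₂ refl

i*j≡1⇒∣i∣*∣j∣≡1 : ∀ i j → i * j ≡ 1ℤ → ∣ i ∣ ℕ.* ∣ j ∣ ≡ 1
i*j≡1⇒∣i∣*∣j∣≡1 i j ij≡1 = trans (sym (ℤP.abs-* i j)) (cong ∣_∣ ij≡1)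

i*i≡1⇒i≡±1 : ∀ i → i * i ≡ 1ℤ → i ≡ 1ℤ ⊎ i ≡ -1ℤ
i*i≡1⇒i≡±1 i ii≡1 = ∣i∣≡1⇒i≡±1 i (ℕP.m*n≡1⇒m≡1 ∣ i ∣ ∣ i ∣ (i*j≡1⇒∣i∣*∣j∣≡1 i i ii≡1))

i*j≡1⇒i≡j : ∀ i j → i * j ≡ 1ℤ → i ≡ j
i*j≡1⇒i≡j i j ij≡1
  with ∣i∣≡1⇒i≡±1 i (ℕP.m*n≡1⇒m≡1 ∣ i ∣ ∣ j ∣ (i*j≡1⇒∣i∣*∣j∣≡1 i j ij≡1))
     | ∣i∣≡1⇒i≡±1 j (ℕP.m*n≡1⇒n≡1 ∣ i ∣ ∣ j ∣ (i*j≡1⇒∣i∣*∣j∣≡1 i j ij≡1))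
... | inj₁ refl | inj₁ refl = refl
... | inj₂ refl | inj₂ refl = refl
... | inj₁ refl | inj₂ refl = contradiction ij≡1 λ ()
... | inj₂ refl | inj₁ refl = contradiction ij≡1 λ ()

i*j≡1⇒i*i≡1 : ∀ i j → i * j ≡ 1ℤ → i * i ≡ 1ℤ
i*j≡1⇒i*i≡1 i j ij≡1 = trans (cong (i *_) (i*j≡1⇒i≡j i j ij≡1)) ij≡1

i*i≡1⇒i≢0 : ∀ i → i * i ≡ 1ℤ → i ≢ 0ℤ
i*i≡1⇒i≢0 .(+ 0) () refl

a*b≡1⇒a*[b*x]≡x : ∀ a b x → a * b ≡ 1ℤ → a * (b * x) ≡ x
a*b≡1⇒a*[b*x]≡x a b x ab≡1 =
  trans (sym (ℤP.*-assoc a b x)) (trans (cong (_* x) ab≡1) (ℤP.*-identityˡ x))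

x*[a*-[a*x]]≡-x*x : ∀ a x → a * a ≡ 1ℤ → x * (a * - (a * x)) ≡ - (x * x)
x*[a*-[a*x]]≡-x*x a x aa≡1 = begin
  x * (a * - (a * x))    ≡⟨ expand a x ⟩
  - (a * a * (x * x))    ≡⟨ cong (λ u → - (u * (x * x))) aa≡1 ⟩
  - (1ℤ * (x * x))       ≡⟨ cong -_ (ℤP.*-identityˡ (x * x)) ⟩
  - (x * x)              ∎
  where
  open ≡-Reasoning
  expand : ∀ a x → x * (a * - (a * x)) ≡ - (a * a * (x * x))
  expand = solve-∀

x*[a*[a*x]]≡x*x : ∀ a x → a * a ≡ 1ℤ → x * (a * (a * x)) ≡ x * x
x*[a*[a*x]]≡x*x a x aa≡1 = begin
  x * (a * (a * x))      ≡⟨ expand a x ⟩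
  a * a * (x * x)        ≡⟨ cong (_* (x * x)) aa≡1 ⟩
  1ℤ * (x * x)           ≡⟨ ℤP.*-identityˡ (x * x) ⟩
  x * x                  ∎
  where
  open ≡-Reasoning
  expand : ∀ a x → x * (a * (a * x)) ≡ a * a * (x * x)
  expand = solve-∀

-[a*-[a*x]]≡x : ∀ a x → a * a ≡ 1ℤ → - (a * - (a * x)) ≡ x
-[a*-[a*x]]≡x a x aa≡1 = begin
  - (a * - (a * x))      ≡⟨ expand a x ⟩
  a * a * x              ≡⟨ cong (_* x) aa≡1 ⟩
  1ℤ * x                 ≡⟨ ℤP.*-identityˡ x ⟩
  x                      ∎
  where
  open ≡-Reasoning
  expand : ∀ a x → - (a * - (a * x)) ≡ a * a * x
  expand = solve-∀

0<i*j⇒i≢0 : ∀ i j → 0ℤ ℤ.< i * j → i ≢ 0ℤ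
0<i*j⇒i≢0 .(+ 0) j (ℤ.+<+ ()) refl

0<i*j⇒0<k*j : ∀ i j k → 0ℤ ℤ.< i * j → k ≢ 0ℤ → sign k ≡ sign i → 0ℤ ℤ.< k * j
0<i*j⇒0<k*j i        j        (+ 0)    _  k≢0 _ = contradiction refl k≢0
0<i*j⇒0<k*j (+ 0)    j        k        (ℤ.+<+ ()) _ _
0<i*j⇒0<k*j i        (+ 0)    k        0<ij _ _ =
  contradiction (subst (0ℤ ℤ.<_) (ℤP.*-zeroʳ i) 0<ij) (ℤP.<-irrefl refl)
0<i*j⇒0<k*j +[1+ _ ] +[1+ _ ] +[1+ _ ] _ _ _ = ℤ.+<+ (s≤s z≤n)
0<i*j⇒0<k*j -[1+ _ ] -[1+ _ ] -[1+ _ ] _ _ _ = ℤ.+<+ (s≤s z≤n)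
0<i*j⇒0<k*j +[1+ _ ] -[1+ _ ] _        () _ _
0<i*j⇒0<k*j -[1+ _ ] +[1+ _ ] _        () _ _
0<i*j⇒0<k*j +[1+ _ ] _        -[1+ _ ] _ _ ()
0<i*j⇒0<k*j -[1+ _ ] _        +[1+ _ ] _ _ ()

sign-neg : ∀ i → i ≢ 0ℤ → sign (- i) ≡ opposite (sign i)
sign-neg (+ 0)    i≢0 = contradiction refl i≢0
sign-neg +[1+ _ ] _   = refl
sign-neg -[1+ _ ] _   = refl

0<i+i-[j+j]⇒j<i : ∀ i j → 0ℤ ℤ.< i + i - (j + j) → j ℤ.< i
0<i+i-[j+j]⇒j<i i j 0<d = ℤP.≰⇒> (λ i≤j → ℤP.<⇒≱ 0<d (ℤP.i≤j⇒i-j≤0 (ℤP.+-mono-≤ i≤j i≤j)))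

0<i<1-impossible : ∀ {i} → 0ℤ ℤ.< i → i ℤ.< 1ℤ → ⊥
0<i<1-impossible (ℤ.+<+ 0<m) (ℤ.+<+ m<1) = ℕP.<⇒≱ 0<m (ℕP.≤-pred m<1)

0<i<2⇒i≡1 : ∀ {i} → 0ℤ ℤ.< i → i ℤ.< + 2 → i ≡ 1ℤ
0<i<2⇒i≡1 {+ 1}           _          _                     = refl
0<i<2⇒i≡1 {+ 0}           (ℤ.+<+ ()) _
0<i<2⇒i≡1 {+ suc (suc m)} _          (ℤ.+<+ (s≤s (s≤s ())))

-- The embedding ℤ → ℚ

ℤ→ℚ≡fromℤ : ∀ i → ℤ→ℚ i ≡ fromℤ i
ℤ→ℚ≡fromℤ i = ℚP.fromℚᵘ-toℚᵘ (fromℤ i)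

ℤ→ℚ-homo-+ : ∀ i j → ℤ→ℚ (i + j) ≡ ℤ→ℚ i ℚ.+ ℤ→ℚ j
ℤ→ℚ-homo-+ i j rewrite ℤ→ℚ≡fromℤ (i + j) | ℤ→ℚ≡fromℤ i | ℤ→ℚ≡fromℤ j =
  ℚP.toℚᵘ-injective (ℚᵘP.≃-trans (ℚᵘ.*≡* (cross-multiplied i j))
                                  (ℚᵘP.≃-sym (ℚP.toℚᵘ-homo-+ (fromℤ i) (fromℤ j))))
  where
  cross-multiplied : ∀ i j → (i + j) * 1ℤ ≡ (i * 1ℤ + j * 1ℤ) * 1ℤ
  cross-multiplied = solve-∀

ℤ→ℚ-homo-* : ∀ i j → ℤ→ℚ (i * j) ≡ ℤ→ℚ i ℚ.* ℤ→ℚ j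
ℤ→ℚ-homo-* i j rewrite ℤ→ℚ≡fromℤ (i * j) | ℤ→ℚ≡fromℤ i | ℤ→ℚ≡fromℤ j =
  ℚP.toℚᵘ-injective (ℚᵘP.≃-sym (ℚP.toℚᵘ-homo-* (fromℤ i) (fromℤ j)))

ℤ→ℚ-injective : ∀ i j → ℤ→ℚ i ≡ ℤ→ℚ j → i ≡ j
ℤ→ℚ-injective i j eq rewrite ℤ→ℚ≡fromℤ i | ℤ→ℚ≡fromℤ j = cong ℚ.numerator eq

ℤ→ℚ-cancel-< : ∀ i j → ℤ→ℚ i ℚ.< ℤ→ℚ j → i ℤ.< j
ℤ→ℚ-cancel-< i j lt rewrite ℤ→ℚ≡fromℤ i | ℤ→ℚ≡fromℤ j with lt
... | ℚ.*<* i*1<j*1 = subst₂ ℤ._<_ (ℤP.*-identityʳ i) (ℤP.*-identityʳ j) i*1<j*1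

ℤ→ℚ-nonZero : ∀ i → i ≢ 0ℤ → ℚ.NonZero (ℤ→ℚ i)
ℤ→ℚ-nonZero i i≢0 = ℚ.≢-nonZero (i≢0 ∘ ℤ→ℚ-injective i 0ℤ)

*-cancelʳ-≡ : ∀ p q r .{{_ : ℚ.NonZero r}} → p ℚ.* r ≡ q ℚ.* r → p ≡ q
*-cancelʳ-≡ p q r pr≡qr = begin
  p                        ≡⟨ sym (ℚP.*-identityʳ p) ⟩
  p ℚ.* 1ℚ                 ≡⟨ cong (p ℚ.*_) (sym (ℚP.*-inverseʳ r)) ⟩
  p ℚ.* (r ℚ.* ℚ.1/ r)     ≡⟨ sym (ℚP.*-assoc p r _) ⟩
  p ℚ.* r ℚ.* ℚ.1/ r       ≡⟨ cong (ℚ._* ℚ.1/ r) pr≡qr ⟩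
  q ℚ.* r ℚ.* ℚ.1/ r       ≡⟨ ℚP.*-assoc q r _ ⟩
  q ℚ.* (r ℚ.* ℚ.1/ r)     ≡⟨ cong (q ℚ.*_) (ℚP.*-inverseʳ r) ⟩
  q ℚ.* 1ℚ                 ≡⟨ ℚP.*-identityʳ q ⟩
  q                        ∎
  where open ≡-Reasoning

-- Finite sums and quadratic forms

∑ℤ : ∀ {n} → (Fin n → ℤ) → ℤ
∑ℤ {zero}  f = 0ℤ
∑ℤ {suc n} f = f zero + ∑ℤ (λ i → f (suc i))

sumℤ : List ℤ → ℤ
sumℤ = foldr _+_ 0ℤ

∑ℤ-zero : ∀ {n} (f : Fin n → ℤ) → (∀ i → f i ≡ 0ℤ) → ∑ℤ f ≡ 0ℤ
∑ℤ-zero {zero}  f f≡0 = refl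
∑ℤ-zero {suc n} f f≡0
  rewrite f≡0 zero | ∑ℤ-zero (λ i → f (suc i)) (λ i → f≡0 (suc i)) = refl

∑ℤ-updateAt-0 : ∀ {n} (f : Fin n → ℤ) a → ∑ℤ f ≡ f a + ∑ℤ (updateAt f a (const 0ℤ))
∑ℤ-updateAt-0 {suc n} f zero = cong (λ s → f zero + s) (sym (ℤP.+-identityˡ _))
∑ℤ-updateAt-0 {suc n} f (suc a)
  rewrite ∑ℤ-updateAt-0 (λ i → f (suc i)) a =
  +-exchange (f zero) (f (suc a)) (∑ℤ (updateAt (λ i → f (suc i)) a (const 0ℤ)))
  where
  +-exchange : ∀ x y z → x + (y + z) ≡ y + (x + z)
  +-exchange = solve-∀

∑ℤ-support : ∀ {n} (f : Fin n → ℤ) (xs : List (Fin n)) → AllPairs _≢_ xs →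
             (∀ i → All (i ≢_) xs → f i ≡ 0ℤ) → ∑ℤ f ≡ sumℤ (map f xs)
∑ℤ-support f []       []                 f≡0 = ∑ℤ-zero f (λ i → f≡0 i [])
∑ℤ-support f (a ∷ xs) (a∉xs ∷ distinct) f≡0 = begin
  ∑ℤ f                              ≡⟨ ∑ℤ-updateAt-0 f a ⟩
  f a + ∑ℤ f′                       ≡⟨ cong (λ s → f a + s) (∑ℤ-support f′ xs distinct f′≡0) ⟩
  f a + sumℤ (map f′ xs)            ≡⟨ cong (λ ys → f a + sumℤ ys) (f′≡f-on-xs xs a∉xs) ⟩
  f a + sumℤ (map f xs)             ∎
  where
  open ≡-Reasoning
  f′ = updateAt f a (const 0ℤ)
  f′≡0 : ∀ i → All (i ≢_) xs → f′ i ≡ 0ℤ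
  f′≡0 i i∉xs with i FinP.≟ a
  ... | yes refl = updateAt-updates a f
  ... | no i≢a   = trans (updateAt-minimal i a f i≢a) (f≡0 i (i≢a ∷ i∉xs))
  f′≡f-on-xs : ∀ ys → All (a ≢_) ys → map f′ ys ≡ map f ys
  f′≡f-on-xs []       []           = refl
  f′≡f-on-xs (y ∷ ys) (a≢y ∷ a∉ys) =
    cong₂ _∷_ (updateAt-minimal y a f (a≢y ∘ sym)) (f′≡f-on-xs ys a∉ys)

∑ℚ-cong : ∀ {n} {f g : Fin n → ℚ} → (∀ i → f i ≡ g i) → ∑ℚ f ≡ ∑ℚ g
∑ℚ-cong {zero}  f≗g = refl
∑ℚ-cong {suc n} f≗g = cong₂ ℚ._+_ (f≗g zero) (∑ℚ-cong (λ i → f≗g (suc i)))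

∑ℚ-scale : ∀ {n} (q : ℚ) (f : Fin n → ℤ) → ∑ℚ (λ i → q ℚ.* ℤ→ℚ (f i)) ≡ q ℚ.* ℤ→ℚ (∑ℤ f)
∑ℚ-scale {zero}  q f = sym (ℚP.*-zeroʳ q)
∑ℚ-scale {suc n} q f
  rewrite ∑ℚ-scale q (λ i → f (suc i)) | ℤ→ℚ-homo-+ (f zero) (∑ℤ (λ i → f (suc i))) =
  sym (ℚP.*-distribˡ-+ q (ℤ→ℚ (f zero)) _)

quadRow : ∀ {n} → Matrix n → (Fin n → ℤ) → Fin n → ℤ
quadRow A x i = ∑ℤ (λ j → x i * A i j * x j)

quadraticForm≡∑rows : ∀ {n} (A : Matrix n) (d : Fin n → ℚ) (x : Fin n → ℤ) →
  ∑ℚ (λ i → ∑ℚ (λ j → ℤ→ℚ (x i) ℚ.* (d i ℚ.* ℤ→ℚ (A i j)) ℚ.* ℤ→ℚ (x j)))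
    ≡ ∑ℚ (λ i → d i ℚ.* ℤ→ℚ (quadRow A x i))
quadraticForm≡∑rows A d x = ∑ℚ-cong λ i →
  trans (∑ℚ-cong (summand i)) (∑ℚ-scale (d i) (λ j → x i * A i j * x j))
  where
  open +-*-Solver
  summand : ∀ i j → ℤ→ℚ (x i) ℚ.* (d i ℚ.* ℤ→ℚ (A i j)) ℚ.* ℤ→ℚ (x j)
                    ≡ d i ℚ.* ℤ→ℚ (x i * A i j * x j)
  summand i j rewrite ℤ→ℚ-homo-* (x i * A i j) (x j) | ℤ→ℚ-homo-* (x i) (A i j) =
    solve 4 (λ x a y q → x :* (q :* a) :* y := q :* (x :* a :* y)) refl
            (ℤ→ℚ (x i)) (ℤ→ℚ (A i j)) (ℤ→ℚ (x j)) (d i)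

-- The cycle

module Cycle (n : ℕ) (3≤M : 3 ≤ suc n) where

  M : ℕ
  M = suc n

  vertex : ℕ → Fin M
  vertex t = t mod M

  toℕ-vertex : ∀ {t} → t < M → toℕ (vertex t) ≡ t
  toℕ-vertex {t} t<M = trans (FinP.toℕ-fromℕ< _) (m<n⇒m%n≡m t<M)

  vertex-toℕ : ∀ (i : Fin M) → vertex (toℕ i) ≡ i
  vertex-toℕ i = FinP.toℕ-injective (toℕ-vertex (FinP.toℕ<n i))

  toℕ≡⇒≡vertex : ∀ {i : Fin M} {t} → toℕ i ≡ t → i ≡ vertex t
  toℕ≡⇒≡vertex {i} eq = trans (sym (vertex-toℕ i)) (cong vertex eq)

  vertex-injective : ∀ {s t} → s < M → t < M → vertex s ≡ vertex t → s ≡ t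
  vertex-injective s<M t<M eq = trans (sym (toℕ-vertex s<M)) (trans (cong toℕ eq) (toℕ-vertex t<M))

  next : ℕ → ℕ
  next t with suc t ℕ.≟ M
  ... | yes _ = 0
  ... | no _  = suc t

  prev : ℕ → ℕ
  prev zero    = n
  prev (suc t) = t

  next-last : ∀ {t} → suc t ≡ M → next t ≡ 0
  next-last {t} eq with suc t ℕ.≟ M
  ... | yes _  = refl
  ... | no neq = contradiction eq neq

  next-suc : ∀ {t} → suc t < M → next t ≡ suc t
  next-suc {t} lt with suc t ℕ.≟ M
  ... | yes eq = contradiction eq (ℕP.<⇒≢ lt)
  ... | no _   = refl

  next<M : ∀ {t} → t < M → next t < M
  next<M {t} t<M with ℕP.m≤n⇒m<n∨m≡n t<M
  ... | inj₁ lt rewrite next-suc lt = lt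
  ... | inj₂ eq rewrite next-last eq = s≤s z≤n

  prev<M : ∀ {t} → t < M → prev t < M
  prev<M {zero}  _         = ℕP.≤-refl
  prev<M {suc t} (s≤s t<n) = ℕP.m≤n⇒m≤1+n t<n

  next-prev : ∀ {t} → t < M → next (prev t) ≡ t
  next-prev {zero}  _   = next-last refl
  next-prev {suc t} t<M = next-suc t<M

  prev-next : ∀ {t} → t < M → prev (next t) ≡ t
  prev-next {t} t<M with ℕP.m≤n⇒m<n∨m≡n t<M
  ... | inj₁ lt rewrite next-suc lt = refl
  ... | inj₂ eq rewrite next-last eq = ℕP.suc-injective (sym eq)

  1<n : 1 < n
  1<n = ℕP.≤-pred 3≤M

  next≢id : ∀ {t} → t < M → next t ≢ t
  next≢id {t} t<M with ℕP.m≤n⇒m<n∨m≡n t<M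
  ... | inj₁ lt   rewrite next-suc lt   = ℕP.1+n≢n
  ... | inj₂ last rewrite next-last last =
    λ 0≡t → ℕP.<⇒≢ (ℕP.<-trans (s≤s z≤n) 1<n) (trans 0≡t (ℕP.suc-injective last))

  prev≢id : ∀ {t} → t < M → prev t ≢ t
  prev≢id t<M eq = next≢id (prev<M t<M) (trans (next-prev t<M) (sym eq))

  next≢prev : ∀ {t} → t < M → next t ≢ prev t
  next≢prev {zero}  _   eq = ℕP.<⇒≢ 1<n (trans (sym (next-suc (ℕP.m≤n⇒m≤1+n 1<n))) eq)
  next≢prev {suc t} t<M eq with ℕP.m≤n⇒m<n∨m≡n t<M
  ... | inj₁ lt   = ℕP.<⇒≢ (ℕP.m<n⇒m<1+n (ℕP.n<1+n t)) (sym (trans (sym (next-suc lt)) eq))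
  ... | inj₂ last = ℕP.<⇒≢ 1<n (trans (cong suc (trans (sym (next-last last)) eq)) (ℕP.suc-injective last))

  private
    stepℕ : ℕ → ℕ → Bool
    stepℕ a b = (suc a ≡ᵇ b) ∨ ((suc a ≡ᵇ M) ∧ (b ≡ᵇ 0))

    next⇒stepℕ : ∀ {a} → a < M → T (stepℕ a (next a))
    next⇒stepℕ {a} a<M with ℕP.m≤n⇒m<n∨m≡n a<M
    ... | inj₁ lt   rewrite next-suc lt    = Equivalence.from T-∨ (inj₁ (ℕP.≡⇒≡ᵇ (suc a) (suc a) refl))
    ... | inj₂ last rewrite next-last last =
      Equivalence.from T-∨ (inj₂ (Equivalence.from T-∧ (ℕP.≡⇒≡ᵇ (suc a) M last , _)))

    stepℕ⇒next : ∀ {a b} → b < M → T (stepℕ a b) → b ≡ next a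
    stepℕ⇒next {a} {b} b<M st with Equivalence.to T-∨ st
    ... | inj₁ suc-a≡b = let e = ℕP.≡ᵇ⇒≡ (suc a) b suc-a≡b in
      trans (sym e) (sym (next-suc (subst (_< M) (sym e) b<M)))
    ... | inj₂ wraps with Equivalence.to T-∧ wraps
    ...   | last , b≡0 = trans (ℕP.≡ᵇ⇒≡ b 0 b≡0) (sym (next-last (ℕP.≡ᵇ⇒≡ (suc a) M last)))

  next⇒stepᵇ : ∀ (i j : Fin M) → toℕ j ≡ next (toℕ i) → T (stepᵇ M i j)
  next⇒stepᵇ i j eq = subst (T ∘ stepℕ (toℕ i)) (sym eq) (next⇒stepℕ (FinP.toℕ<n i))

  adjacent⇔step : ∀ {i j : Fin M} → Adjacent M i j ⇔ (T (stepᵇ M i j) ⊎ T (stepᵇ M j i))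
  adjacent⇔step {i} {j} = T-∨ {stepᵇ M i j} {stepᵇ M j i}

  adjacent-next : ∀ {t} → t < M → Adjacent M (vertex t) (vertex (next t))
  adjacent-next {t} t<M =
    Equivalence.from (adjacent⇔step {vertex t} {vertex (next t)})
      (inj₁ (next⇒stepᵇ (vertex t) (vertex (next t))
               (trans (toℕ-vertex (next<M t<M)) (cong next (sym (toℕ-vertex t<M))))))

  adjacent-prev : ∀ {t} → t < M → Adjacent M (vertex t) (vertex (prev t))
  adjacent-prev {t} t<M =
    Equivalence.from (adjacent⇔step {vertex t} {vertex (prev t)})
      (inj₂ (next⇒stepᵇ (vertex (prev t)) (vertex t)
               (trans (toℕ-vertex t<M) (trans (sym (next-prev t<M)) (cong next (sym (toℕ-vertex (prev<M t<M))))))))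

  adjacent⇒next⊎prev : ∀ (i j : Fin M) → Adjacent M i j → toℕ j ≡ next (toℕ i) ⊎ toℕ j ≡ prev (toℕ i)
  adjacent⇒next⊎prev i j adj with Equivalence.to (adjacent⇔step {i} {j}) adj
  ... | inj₁ i→j = inj₁ (stepℕ⇒next (FinP.toℕ<n j) i→j)
  ... | inj₂ j→i = inj₂ (trans (sym (prev-next (FinP.toℕ<n j))) (cong prev (sym (stepℕ⇒next (FinP.toℕ<n i) j→i))))

-- Sign patterns on marked positions

opposite^ : ℕ → Sign → Sign
opposite^ zero    s = s
opposite^ (suc k) s = opposite (opposite^ k s)

opposite^-even : ∀ k s → opposite^ (2 ℕ.* k) s ≡ s
opposite^-even zero    s = refl
opposite^-even (suc k) s rewrite ℕP.+-suc k (k ℕ.+ 0) =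
  trans (SignP.opposite-involutive (opposite^ (2 ℕ.* k) s)) (opposite^-even k s)

∑ℕ-cong : ∀ {n} {f g : Fin n → ℕ} → (∀ i → f i ≡ g i) → ∑ℕ f ≡ ∑ℕ g
∑ℕ-cong {zero}  f≗g = refl
∑ℕ-cong {suc n} f≗g = cong₂ ℕ._+_ (f≗g zero) (∑ℕ-cong (λ i → f≗g (suc i)))

prefixSum : (ℕ → ℕ) → ℕ → ℕ
prefixSum f zero    = 0
prefixSum f (suc t) = prefixSum f t ℕ.+ f t

prefixSum-suc : ∀ f t → f 0 ℕ.+ prefixSum (λ u → f (suc u)) t ≡ prefixSum f (suc t)
prefixSum-suc f zero    = ℕP.+-comm (f 0) 0
prefixSum-suc f (suc t) =
  trans (sym (ℕP.+-assoc (f 0) _ (f (suc t)))) (cong (ℕ._+ f (suc t)) (prefixSum-suc f t))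

∑ℕ≡prefixSum : ∀ t f → ∑ℕ {t} (λ i → f (toℕ i)) ≡ prefixSum f t
∑ℕ≡prefixSum zero    f = refl
∑ℕ≡prefixSum (suc t) f =
  trans (cong (f 0 ℕ.+_) (∑ℕ≡prefixSum t (λ u → f (suc u)))) (prefixSum-suc f t)

module Alternation (c : ℕ → ℕ) (s : ℕ → Sign) where

  marks : ℕ → ℕ
  marks = prefixSum (λ t → if c t ≡ᵇ 0 then 0 else 1)

  marks-unmarked : ∀ {t} → c t ≡ 0 → marks (suc t) ≡ marks t
  marks-unmarked {t} ct≡0 rewrite dec-true (c t ℕ.≟ 0) ct≡0 = ℕP.+-identityʳ (marks t)

  marks-marked : ∀ {t} → c t ≢ 0 → marks (suc t) ≡ suc (marks t)
  marks-marked {t} ct≢0 rewrite dec-false (c t ℕ.≟ 0) ct≢0 = ℕP.+-comm (marks t) 1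

  record EqualNeighbours (bound : ℕ) : Set where
    field
      {p q}            : ℕ
      p<q              : p < q
      q<bound          : q < bound
      marked-p         : c p ≢ 0
      marked-q         : c q ≢ 0
      unmarked-between : ∀ u → p < u → u < q → c u ≡ 0
      same-sign        : s p ≡ s q

  record OppositeEnds (bound : ℕ) : Set where
    field
      {first last}     : ℕ
      first<last       : first < last
      last<bound       : last < bound
      marked-first     : c first ≢ 0
      marked-last      : c last ≢ 0
      unmarked-before  : ∀ u → u < first → c u ≡ 0
      unmarked-after   : ∀ u → last < u → u < bound → c u ≡ 0
      opposite-signs   : s first ≡ opposite (s last)

  private
    data Scan (t : ℕ) : Set where
      equal       : EqualNeighbours t → Scan t
      unmarked    : (∀ u → u < t → c u ≡ 0) → marks t ≡ 0 → Scan t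
      -- no two consecutive marked positions among the first (f) and the last (l) share a
      -- sign, so the sign flips marks t − 1 times between them
      alternating : ∀ {f l} → f ≤ l → l < t → c f ≢ 0 → c l ≢ 0 →
                    (∀ u → u < f → c u ≡ 0) → (∀ u → l < u → u < t → c u ≡ 0) →
                    opposite (s l) ≡ opposite^ (marks t) (s f) → Scan t

    unmarked-below-suc : ∀ {t} → (∀ u → u < t → c u ≡ 0) → c t ≡ 0 → ∀ u → u < suc t → c u ≡ 0
    unmarked-below-suc none ct≡0 u u<1+t with ℕP.m≤n⇒m<n∨m≡n (ℕP.≤-pred u<1+t)
    ... | inj₁ u<t  = none u u<t
    ... | inj₂ refl = ct≡0

    unmarked-between-suc : ∀ {l t} → (∀ u → l < u → u < t → c u ≡ 0) → c t ≡ 0 →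
                           ∀ u → l < u → u < suc t → c u ≡ 0
    unmarked-between-suc none ct≡0 u l<u u<1+t with ℕP.m≤n⇒m<n∨m≡n (ℕP.≤-pred u<1+t)
    ... | inj₁ u<t  = none u l<u u<t
    ... | inj₂ refl = ct≡0

    equal-suc : ∀ {t} → EqualNeighbours t → EqualNeighbours (suc t)
    equal-suc e = record
      { p<q = p<q ; q<bound = ℕP.m<n⇒m<1+n q<bound ; marked-p = marked-p ; marked-q = marked-q
      ; unmarked-between = unmarked-between ; same-sign = same-sign }
      where open EqualNeighbours e

    nothing-between : ∀ {t} u → t < u → u < suc t → c u ≡ 0
    nothing-between u t<u u<1+t = contradiction (ℕP.≤-pred u<1+t) (ℕP.<⇒≱ t<u)

    ≢⇒≡opposite : ∀ {a b : Sign} → a ≢ b → b ≡ opposite a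
    ≢⇒≡opposite {Sign.+} {Sign.+} a≢b = contradiction refl a≢b
    ≢⇒≡opposite {Sign.+} {Sign.-} _   = refl
    ≢⇒≡opposite {Sign.-} {Sign.+} _   = refl
    ≢⇒≡opposite {Sign.-} {Sign.-} a≢b = contradiction refl a≢b

    scan : ∀ t → Scan t
    scan zero = unmarked (λ _ ()) refl
    scan (suc t) with scan t | c t ℕ.≟ 0
    ... | equal e | _ = equal (equal-suc e)
    ... | unmarked none marks≡0 | yes ct≡0 =
      unmarked (unmarked-below-suc none ct≡0) (trans (marks-unmarked ct≡0) marks≡0)
    ... | unmarked none marks≡0 | no ct≢0 =
      alternating ℕP.≤-refl ℕP.≤-refl ct≢0 ct≢0 none nothing-between
        (cong (λ j → opposite^ j (s t)) (sym (trans (marks-marked ct≢0) (cong suc marks≡0))))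
    ... | alternating {f} f≤l l<t cf cl before after signs | yes ct≡0 =
      alternating f≤l (ℕP.m<n⇒m<1+n l<t) cf cl before (unmarked-between-suc after ct≡0)
        (trans signs (cong (λ j → opposite^ j (s f)) (sym (marks-unmarked ct≡0))))
    ... | alternating {f} {l} f≤l l<t cf cl before after signs | no ct≢0 with s l SignP.≟ s t
    ...   | yes same = equal (record { p<q = l<t ; q<bound = ℕP.≤-refl ; marked-p = cl ; marked-q = ct≢0
                                     ; unmarked-between = after ; same-sign = same })
    ...   | no differ =
      alternating (ℕP.≤-trans f≤l (ℕP.<⇒≤ l<t)) ℕP.≤-refl cf ct≢0 before
        nothing-between
        (begin
          opposite (s t)                          ≡⟨ cong opposite (≢⇒≡opposite differ) ⟩
          opposite (opposite (s l))               ≡⟨ cong opposite signs ⟩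
          opposite (opposite^ (marks t) (s f))    ≡⟨ cong (λ j → opposite^ j (s f)) (sym (marks-marked ct≢0)) ⟩
          opposite^ (marks (suc t)) (s f)         ∎)
      where open ≡-Reasoning

  equal-neighbours-or-opposite-ends : ∀ bound k → 0 < marks bound → marks bound ≡ 2 ℕ.* k →
                EqualNeighbours bound ⊎ OppositeEnds bound
  equal-neighbours-or-opposite-ends bound k marks>0 even with scan bound
  ... | equal e = inj₁ e
  ... | unmarked _ marks≡0 = contradiction marks≡0 (ℕP.>⇒≢ marks>0)
  ... | alternating {f} {l} f≤l l<bound cf cl before after signs =
    ends (ℕP.m≤n⇒m<n∨m≡n f≤l)
         (trans signs (trans (cong (λ j → opposite^ j (s f)) even) (opposite^-even k (s f))))
    where
    ends : f < l ⊎ f ≡ l → opposite (s l) ≡ s f → EqualNeighbours bound ⊎ OppositeEnds bound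
    ends (inj₂ refl) signs′ = contradiction (sym signs′) (SignP.s≢opposite[s] (s f))
    ends (inj₁ f<l)  signs′ = inj₂ (record
      { first<last = f<l ; last<bound = l<bound ; marked-first = cf ; marked-last = cl
      ; unmarked-before = before ; unmarked-after = after ; opposite-signs = sym signs′ })

-- A positive realisation of Γ

module PositiveRealisation
  (n : ℕ) (3≤M : 3 ≤ suc n) (c : Fin (suc n) → ℕ)
  (A : Matrix (suc (suc n))) (d : Fin (suc (suc n)) → ℚ)
  (A-diag : ∀ i → A i i ≡ + 2)
  (d>0 : ∀ i → 0ℚ ℚ.< d i)
  (d-symmetrizes : ∀ i j → d i ℚ.* ℤ→ℚ (A i j) ≡ d j ℚ.* ℤ→ℚ (A j i))
  (DA-posdef : PositiveDefinite (λ i j → d i ℚ.* ℤ→ℚ (A i j)))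
  (sg : SignAssignment (suc (suc n)))
  (A-diagram : IsDiagramOf A (Γ (suc n) 3≤M c) sg)
  where

  open Cycle n 3≤M

  k : Fin (suc M)
  k = zero

  ⟨_⟩ : ℕ → Fin (suc M)
  ⟨ t ⟩ = suc (vertex t)

  -- entries of A between cycle vertices (ᶻ) and the new vertex k (ᵏ)
  Aᶻ : ℕ → ℕ → ℤ
  Aᶻ t u = A ⟨ t ⟩ ⟨ u ⟩

  Aᶻᵏ Aᵏᶻ : ℕ → ℤ
  Aᶻᵏ t = A ⟨ t ⟩ k
  Aᵏᶻ t = A k ⟨ t ⟩

  cᶻ : ℕ → ℕ
  cᶻ t = c (vertex t)

  ⟨⟩-injective : ∀ {s t} → s < M → t < M → s ≢ t → ⟨ s ⟩ ≢ ⟨ t ⟩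
  ⟨⟩-injective s<M t<M s≢t eq = s≢t (vertex-injective s<M t<M (FinP.suc-injective eq))

  suc≢⟨⟩⇒toℕ≢ : ∀ {j : Fin M} {t} → suc j ≢ ⟨ t ⟩ → toℕ j ≢ t
  suc≢⟨⟩⇒toℕ≢ j≢t eq = j≢t (cong suc (toℕ≡⇒≡vertex eq))

  private
    G : EdgeWeightedGraph (suc M)
    G = Γ M 3≤M c

  A-zero : ∀ {i j} → i ≢ j → weight G i j ≡ 0 → A i j ≡ 0ℤ
  A-zero {i} {j} i≢j w≡0 with A i j ℤ.≟ 0ℤ
  ... | yes Aij≡0 = Aij≡0
  ... | no  Aij≢0 = contradiction w≡0 (proj₁ (proj₂ (A-diagram i j i≢j) Aij≢0))

  A-product : ∀ {i j} → i ≢ j → weight G i j ≢ 0 → + weight G i j ≡ A i j * A j i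
  A-product {i} {j} i≢j w≢0 with A i j ℤ.≟ 0ℤ
  ... | yes Aij≡0 = contradiction (proj₁ (A-diagram i j i≢j) Aij≡0) w≢0
  ... | no  Aij≢0 = proj₁ (proj₂ (proj₂ (A-diagram i j i≢j) Aij≢0))

  next-edge : ∀ {t} → t < M → Aᶻ t (next t) * Aᶻ (next t) t ≡ 1ℤ
  next-edge {t} t<M =
    sym (trans (cong +_ (sym weight≡1))
               (A-product (⟨⟩-injective t<M (next<M t<M) (next≢id t<M ∘ sym))
                          (λ w≡0 → contradiction (trans (sym weight≡1) w≡0) λ ())))
    where
    weight≡1 : weight G ⟨ t ⟩ ⟨ next t ⟩ ≡ 1
    weight≡1 = cong (λ b → if b then 1 else 0) (Equivalence.to T-≡ (adjacent-next t<M))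

  Aᶻ-nonadjacent : ∀ {t} → t < M → ∀ (j : Fin M) →
                   toℕ j ≢ t → toℕ j ≢ next t → toℕ j ≢ prev t → A ⟨ t ⟩ (suc j) ≡ 0ℤ
  Aᶻ-nonadjacent {t} t<M j j≢t j≢next j≢prev =
    A-zero (λ eq → j≢t (trans (cong toℕ (sym (FinP.suc-injective eq))) (toℕ-vertex t<M))) weight≡0
    where
    weight≡0 : weight G ⟨ t ⟩ (suc j) ≡ 0
    weight≡0 with adjᵇ M (vertex t) j in adj
    ... | false = refl
    ... | true with adjacent⇒next⊎prev (vertex t) j (Equivalence.from T-≡ adj)
    ...   | inj₁ j≡next = contradiction (trans j≡next (cong next (toℕ-vertex t<M))) j≢next
    ...   | inj₂ j≡prev = contradiction (trans j≡prev (cong prev (toℕ-vertex t<M))) j≢prev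

  Aᶻᵏ-unmarked : ∀ {t} → cᶻ t ≡ 0 → Aᶻᵏ t ≡ 0ℤ
  Aᶻᵏ-unmarked = A-zero (λ ())

  Aᵏᶻ-unmarked : ∀ {t} → cᶻ t ≡ 0 → Aᵏᶻ t ≡ 0ℤ
  Aᵏᶻ-unmarked = A-zero (λ ())

  Aᶻᵏ*Aᵏᶻ : ∀ {t} → cᶻ t ≢ 0 → + cᶻ t ≡ Aᶻᵏ t * Aᵏᶻ t
  Aᶻᵏ*Aᵏᶻ = A-product (λ ())

  Aᶻ-next-unit : ∀ {t} → t < M → Aᶻ t (next t) * Aᶻ t (next t) ≡ 1ℤ
  Aᶻ-next-unit {t} t<M = i*j≡1⇒i*i≡1 (Aᶻ t (next t)) (Aᶻ (next t) t) (next-edge t<M)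

  Aᶻ-next-symmetric : ∀ {t} → t < M → Aᶻ t (next t) ≡ Aᶻ (next t) t
  Aᶻ-next-symmetric {t} t<M = i*j≡1⇒i≡j (Aᶻ t (next t)) (Aᶻ (next t) t) (next-edge t<M)

  prev-edge : ∀ {t} → t < M → Aᶻ t (prev t) * Aᶻ (prev t) t ≡ 1ℤ
  prev-edge {t} t<M = subst (λ u → Aᶻ u (prev t) * Aᶻ (prev t) u ≡ 1ℤ) (next-prev t<M)
                            (trans (ℤP.*-comm (Aᶻ (next (prev t)) (prev t)) (Aᶻ (prev t) (next (prev t))))
                                   (next-edge (prev<M t<M)))

  Aᶻ-prev-unit : ∀ {t} → t < M → Aᶻ t (prev t) * Aᶻ t (prev t) ≡ 1ℤ
  Aᶻ-prev-unit {t} t<M = i*j≡1⇒i*i≡1 (Aᶻ t (prev t)) (Aᶻ (prev t) t) (prev-edge t<M)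

  marked-product : ∀ t x → x * x ≡ 1ℤ → cᶻ t ≢ 0 → Aᶻᵏ t * x * (Aᵏᶻ t * x) ≡ + cᶻ t
  marked-product t x unit ct≢0 = begin
    Aᶻᵏ t * x * (Aᵏᶻ t * x)     ≡⟨ regroup (Aᶻᵏ t) (Aᵏᶻ t) x ⟩
    Aᶻᵏ t * Aᵏᶻ t * (x * x)     ≡⟨ cong₂ _*_ (sym (Aᶻᵏ*Aᵏᶻ {t} ct≢0)) unit ⟩
    + cᶻ t * 1ℤ                 ≡⟨ ℤP.*-identityʳ (+ cᶻ t) ⟩
    + cᶻ t                      ∎
    where
    open ≡-Reasoning
    regroup : ∀ a b x → a * x * (b * x) ≡ a * b * (x * x)
    regroup = solve-∀

  marked-positive : ∀ t x → x * x ≡ 1ℤ → cᶻ t ≢ 0 → 0ℤ ℤ.< Aᶻᵏ t * x * (Aᵏᶻ t * x)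
  marked-positive t x unit ct≢0 =
    subst (0ℤ ℤ.<_) (sym (marked-product t x unit ct≢0)) (ℤ.+<+ (ℕP.n≢0⇒n>0 ct≢0))

  d-next : ∀ {t} → t < M → d ⟨ t ⟩ ≡ d ⟨ next t ⟩
  d-next {t} t<M =
    *-cancelʳ-≡ (d ⟨ t ⟩) (d ⟨ next t ⟩) (ℤ→ℚ a) {{ℤ→ℚ-nonZero a (i*i≡1⇒i≢0 a (Aᶻ-next-unit t<M))}}
      (trans (d-symmetrizes ⟨ t ⟩ ⟨ next t ⟩)
             (cong (λ u → d ⟨ next t ⟩ ℚ.* ℤ→ℚ u) (sym (Aᶻ-next-symmetric t<M))))
    where a = Aᶻ t (next t)

  δ : ℚ
  δ = d ⟨ 0 ⟩

  d-cycle : ∀ {t} → t < M → d ⟨ t ⟩ ≡ δ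
  d-cycle {zero}  _     = refl
  d-cycle {suc t} 1+t<M = begin
    d ⟨ suc t ⟩   ≡⟨ cong (d ∘ ⟨_⟩) (sym (next-suc 1+t<M)) ⟩
    d ⟨ next t ⟩  ≡⟨ sym (d-next t<M) ⟩
    d ⟨ t ⟩       ≡⟨ d-cycle t<M ⟩
    δ             ∎
    where
    open ≡-Reasoning
    t<M = ℕP.<-trans (ℕP.n<1+n t) 1+t<M

  d-suc : ∀ (i : Fin M) → d (suc i) ≡ δ
  d-suc i = trans (cong (d ∘ suc) (sym (vertex-toℕ i))) (d-cycle (FinP.toℕ<n i))

  δ-transfers : ∀ {t} → t < M → δ ℚ.* ℤ→ℚ (Aᶻᵏ t) ≡ d k ℚ.* ℤ→ℚ (Aᵏᶻ t)
  δ-transfers {t} t<M = trans (cong (ℚ._* ℤ→ℚ (Aᶻᵏ t)) (sym (d-cycle t<M))) (d-symmetrizes ⟨ t ⟩ k)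

  cross-ratio : ∀ {p q} → p < M → q < M → Aᶻᵏ p * Aᵏᶻ q ≡ Aᶻᵏ q * Aᵏᶻ p
  cross-ratio {p} {q} p<M q<M = ℤ→ℚ-injective _ _ (*-cancelˡ-δ (begin
    δ ℚ.* ℤ→ℚ (Aᶻᵏ p * Aᵏᶻ q)                   ≡⟨ cong (δ ℚ.*_) (ℤ→ℚ-homo-* (Aᶻᵏ p) (Aᵏᶻ q)) ⟩
    δ ℚ.* (ℤ→ℚ (Aᶻᵏ p) ℚ.* ℤ→ℚ (Aᵏᶻ q))         ≡⟨ sym (ℚP.*-assoc δ _ _) ⟩
    δ ℚ.* ℤ→ℚ (Aᶻᵏ p) ℚ.* ℤ→ℚ (Aᵏᶻ q)           ≡⟨ cong (ℚ._* _) (δ-transfers p<M) ⟩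
    d k ℚ.* ℤ→ℚ (Aᵏᶻ p) ℚ.* ℤ→ℚ (Aᵏᶻ q)         ≡⟨ ℚP.*-assoc (d k) _ _ ⟩
    d k ℚ.* (ℤ→ℚ (Aᵏᶻ p) ℚ.* ℤ→ℚ (Aᵏᶻ q))       ≡⟨ cong (d k ℚ.*_) (ℚP.*-comm (ℤ→ℚ (Aᵏᶻ p)) _) ⟩
    d k ℚ.* (ℤ→ℚ (Aᵏᶻ q) ℚ.* ℤ→ℚ (Aᵏᶻ p))       ≡⟨ sym (ℚP.*-assoc (d k) _ _) ⟩
    d k ℚ.* ℤ→ℚ (Aᵏᶻ q) ℚ.* ℤ→ℚ (Aᵏᶻ p)         ≡⟨ cong (ℚ._* _) (sym (δ-transfers q<M)) ⟩
    δ ℚ.* ℤ→ℚ (Aᶻᵏ q) ℚ.* ℤ→ℚ (Aᵏᶻ p)           ≡⟨ ℚP.*-assoc δ _ _ ⟩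
    δ ℚ.* (ℤ→ℚ (Aᶻᵏ q) ℚ.* ℤ→ℚ (Aᵏᶻ p))         ≡⟨ cong (δ ℚ.*_) (sym (ℤ→ℚ-homo-* (Aᶻᵏ q) (Aᵏᶻ p))) ⟩
    δ ℚ.* ℤ→ℚ (Aᶻᵏ q * Aᵏᶻ p)                   ∎))
    where
    open ≡-Reasoning
    *-cancelˡ-δ : ∀ {x y} → δ ℚ.* x ≡ δ ℚ.* y → x ≡ y
    *-cancelˡ-δ {x} {y} eq = *-cancelʳ-≡ x y δ {{ℚP.pos⇒nonZero δ {{ℚ.positive (d>0 ⟨ 0 ⟩)}}}}
      (trans (ℚP.*-comm x δ) (trans eq (ℚP.*-comm δ y)))

  d-k-transfer : ∀ {t} → t < M → ∀ r → d k ℚ.* ℤ→ℚ (Aᵏᶻ t * r) ≡ δ ℚ.* ℤ→ℚ (Aᶻᵏ t * r)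
  d-k-transfer {t} t<M r = begin
    d k ℚ.* ℤ→ℚ (Aᵏᶻ t * r)               ≡⟨ cong (d k ℚ.*_) (ℤ→ℚ-homo-* (Aᵏᶻ t) r) ⟩
    d k ℚ.* (ℤ→ℚ (Aᵏᶻ t) ℚ.* ℤ→ℚ r)       ≡⟨ sym (ℚP.*-assoc (d k) _ _) ⟩
    d k ℚ.* ℤ→ℚ (Aᵏᶻ t) ℚ.* ℤ→ℚ r         ≡⟨ cong (ℚ._* ℤ→ℚ r) (sym (δ-transfers t<M)) ⟩
    δ ℚ.* ℤ→ℚ (Aᶻᵏ t) ℚ.* ℤ→ℚ r           ≡⟨ ℚP.*-assoc δ _ _ ⟩
    δ ℚ.* (ℤ→ℚ (Aᶻᵏ t) ℚ.* ℤ→ℚ r)         ≡⟨ cong (δ ℚ.*_) (sym (ℤ→ℚ-homo-* (Aᶻᵏ t) r)) ⟩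
    δ ℚ.* ℤ→ℚ (Aᶻᵏ t * r)                 ∎
    where open ≡-Reasoning

  δ*x>0⇒x>0 : ∀ x → 0ℚ ℚ.< δ ℚ.* x → 0ℚ ℚ.< x
  δ*x>0⇒x>0 x 0<δx = ℚP.*-cancelˡ-<-nonNeg δ {{ℚP.pos⇒nonNeg δ {{ℚ.positive (d>0 ⟨ 0 ⟩)}}}}
                       (subst (ℚ._< δ ℚ.* x) (sym (ℚP.*-zeroʳ δ)) 0<δx)

  -- τ propagates along the edges t → t + 1 for t < n by construction; whether it also
  -- propagates along the closing edge n → 0 is the sign invariant of the cycle
  τ : ℕ → ℤ
  τ zero    = 1ℤ
  τ (suc t) = - (Aᶻ t (suc t) * τ t)

  -- along a propagating edge each endpoint u receives −X u ² in its row (link-next,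
  -- link-prev), cancelling half of its diagonal term 2 X u ²
  Propagates : (ℕ → ℤ) → ℕ → Set
  Propagates X t = X (next t) ≡ - (Aᶻ t (next t) * X t)

  τ-unit : ∀ {t} → t < M → τ t * τ t ≡ 1ℤ
  τ-unit {zero}  _     = refl
  τ-unit {suc t} 1+t<M = begin
    - (a * τ t) * - (a * τ t)   ≡⟨ expand a (τ t) ⟩
    a * a * (τ t * τ t)         ≡⟨ cong₂ _*_ a-unit (τ-unit (ℕP.<-trans (ℕP.n<1+n t) 1+t<M)) ⟩
    1ℤ                          ∎
    where
    open ≡-Reasoning
    a = Aᶻ t (suc t)
    a-unit : a * a ≡ 1ℤ
    a-unit = subst (λ u → Aᶻ t u * Aᶻ t u ≡ 1ℤ) (next-suc 1+t<M) (Aᶻ-next-unit (ℕP.<-trans (ℕP.n<1+n t) 1+t<M))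
    expand : ∀ a x → - (a * x) * - (a * x) ≡ a * a * (x * x)
    expand = solve-∀

  propagates-τ : ∀ X {t} → suc t < M → X t ≡ τ t → X (suc t) ≡ τ (suc t) → Propagates X t
  propagates-τ X {t} 1+t<M Xt≡ X1+t≡ rewrite next-suc 1+t<M | Xt≡ = X1+t≡

  propagates-negτ : ∀ X {t} → suc t < M → X t ≡ - τ t → X (suc t) ≡ - τ (suc t) → Propagates X t
  propagates-negτ X {t} 1+t<M Xt≡ X1+t≡ rewrite next-suc 1+t<M | Xt≡ =
    trans X1+t≡ (cong -_ (ℤP.neg-distribʳ-* (Aᶻ t (suc t)) (τ t)))

  propagates-back : ∀ X {t} → t < M → Propagates X (prev t) → X (prev t) ≡ - (Aᶻ t (prev t) * X t)
  propagates-back X {t} t<M prop = begin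
    X (prev t)                         ≡⟨ sym (-[a*-[a*x]]≡x b (X (prev t)) (Aᶻ-prev-unit t<M)) ⟩
    - (b * - (b * X (prev t)))         ≡⟨ cong (λ u → - (b * u)) (sym Xt≡) ⟩
    - (b * X t)                        ∎
    where
    open ≡-Reasoning
    b = Aᶻ t (prev t)
    Xt≡ : X t ≡ - (b * X (prev t))
    Xt≡ = subst₂ (λ u a → X u ≡ - (a * X (prev t))) (next-prev t<M)
                 (trans (cong (Aᶻ (prev t)) (next-prev t<M)) (sym (i*j≡1⇒i≡j b (Aᶻ (prev t) t) (prev-edge t<M))))
                 prop

  extend : (ℕ → ℤ) → ℤ → Fin (suc M) → ℤ
  extend X xk zero    = xk
  extend X xk (suc i) = X (toℕ i)

  extend-⟨⟩ : ∀ X xk {t} → t < M → extend X xk ⟨ t ⟩ ≡ X t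
  extend-⟨⟩ X xk t<M = cong X (toℕ-vertex t<M)

  form : (ℕ → ℤ) → ℤ → ℚ
  form X xk = ∑ℚ (λ i → ∑ℚ (λ j → v i ℚ.* (d i ℚ.* ℤ→ℚ (A i j)) ℚ.* v j))
    where v = ℤ→ℚ ∘ extend X xk

  row : (ℕ → ℤ) → ℤ → Fin (suc M) → ℤ
  row X xk = quadRow A (extend X xk)

  form≡rows : ∀ X xk → form X xk ≡ d k ℚ.* ℤ→ℚ (row X xk k) ℚ.+ δ ℚ.* ℤ→ℚ (∑ℤ (λ i → row X xk (suc i)))
  form≡rows X xk =
    trans (quadraticForm≡∑rows A d (extend X xk))
          (cong (d k ℚ.* ℤ→ℚ (row X xk k) ℚ.+_)
                (trans (∑ℚ-cong (λ i → cong (ℚ._* ℤ→ℚ (row X xk (suc i))) (d-suc i)))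
                       (∑ℚ-scale δ (λ i → row X xk (suc i)))))

  form>0 : ∀ X xk {t} → t < M → X t * X t ≡ 1ℤ → 0ℚ ℚ.< form X xk
  form>0 X xk {t} t<M unit = DA-posdef (ℤ→ℚ ∘ extend X xk) (⟨ t ⟩ , nonzero)
    where
    nonzero : ℤ→ℚ (extend X xk ⟨ t ⟩) ≢ 0ℚ
    nonzero eq = i*i≡1⇒i≢0 (X t) unit (trans (sym (extend-⟨⟩ X xk t<M)) (ℤ→ℚ-injective _ 0ℤ eq))

  link : (ℕ → ℤ) → ℕ → ℕ → ℤ
  link X t u = X t * (Aᶻ t u * X u)

  row-cycle : ∀ X xk {t} → t < M →
              row X xk ⟨ t ⟩ ≡ + 2 * (X t * X t) + (link X t (next t) + link X t (prev t))
                               + X t * (Aᶻᵏ t * xk)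
  row-cycle X xk {t} t<M =
    trans (∑ℤ-support term (⟨ t ⟩ ∷ ⟨ next t ⟩ ∷ ⟨ prev t ⟩ ∷ k ∷ []) distinct outside)
          (collect (extend-⟨⟩ X xk t<M) (extend-⟨⟩ X xk (next<M t<M)) (extend-⟨⟩ X xk (prev<M t<M))
                   (A-diag ⟨ t ⟩))
    where
    term : Fin (suc M) → ℤ
    term j = extend X xk ⟨ t ⟩ * A ⟨ t ⟩ j * extend X xk j
    distinct : AllPairs _≢_ (⟨ t ⟩ ∷ ⟨ next t ⟩ ∷ ⟨ prev t ⟩ ∷ k ∷ [])
    distinct = ( ⟨⟩-injective t<M (next<M t<M) (next≢id t<M ∘ sym)
               ∷ ⟨⟩-injective t<M (prev<M t<M) (prev≢id t<M ∘ sym)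
               ∷ (λ ()) ∷ [])
             ∷ (⟨⟩-injective (next<M t<M) (prev<M t<M) (next≢prev t<M) ∷ (λ ()) ∷ [])
             ∷ ((λ ()) ∷ [])
             ∷ [] ∷ []
    outside : ∀ i → All (i ≢_) (⟨ t ⟩ ∷ ⟨ next t ⟩ ∷ ⟨ prev t ⟩ ∷ k ∷ []) → term i ≡ 0ℤ
    outside zero    (_ ∷ _ ∷ _ ∷ i≢k ∷ []) = contradiction refl i≢k
    outside (suc j) (j≢t ∷ j≢next ∷ j≢prev ∷ _ ∷ []) =
      trans (cong (λ a → extend X xk ⟨ t ⟩ * a * X (toℕ j))
                  (Aᶻ-nonadjacent t<M j (suc≢⟨⟩⇒toℕ≢ j≢t) (suc≢⟨⟩⇒toℕ≢ j≢next) (suc≢⟨⟩⇒toℕ≢ j≢prev)))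
            (x*0*y≡0 (extend X xk ⟨ t ⟩) (X (toℕ j)))
      where
      x*0*y≡0 : ∀ x y → x * 0ℤ * y ≡ 0ℤ
      x*0*y≡0 = solve-∀
    collect : ∀ {x x′ y y′ w w′ two} → x′ ≡ x → y′ ≡ y → w′ ≡ w → two ≡ + 2 →
              x′ * two * x′ + (x′ * Aᶻ t (next t) * y′ + (x′ * Aᶻ t (prev t) * w′ + (x′ * Aᶻᵏ t * xk + 0ℤ)))
                ≡ + 2 * (x * x) + (x * (Aᶻ t (next t) * y) + x * (Aᶻ t (prev t) * w))
                  + x * (Aᶻᵏ t * xk)
    collect {x} {y = y} {w = w} refl refl refl refl =
      ring x (Aᶻ t (next t)) y (Aᶻ t (prev t)) w (Aᶻᵏ t) xk
      where
      ring : ∀ x a y b w e z → x * + 2 * x + (x * a * y + (x * b * w + (x * e * z + 0ℤ)))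
                                ≡ + 2 * (x * x) + (x * (a * y) + x * (b * w)) + x * (e * z)
      ring = solve-∀

  link-next : ∀ X {t} → t < M → Propagates X t → link X t (next t) ≡ - (X t * X t)
  link-next X {t} t<M prop =
    trans (cong (λ u → X t * (Aᶻ t (next t) * u)) prop)
          (x*[a*-[a*x]]≡-x*x (Aᶻ t (next t)) (X t) (Aᶻ-next-unit t<M))

  link-prev : ∀ X {t} → t < M → Propagates X (prev t) → link X t (prev t) ≡ - (X t * X t)
  link-prev X {t} t<M prop =
    trans (cong (λ u → X t * (Aᶻ t (prev t) * u)) (propagates-back X t<M prop))
          (x*[a*-[a*x]]≡-x*x (Aᶻ t (prev t)) (X t) (Aᶻ-prev-unit t<M))

  link-zero : ∀ X {t u} → X u ≡ 0ℤ → link X t u ≡ 0ℤ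
  link-zero X {t} {u} Xu≡0 = trans (cong (λ v → X t * (Aᶻ t u * v)) Xu≡0) (x*[a*0]≡0 (X t) (Aᶻ t u))
    where
    x*[a*0]≡0 : ∀ x a → x * (a * 0ℤ) ≡ 0ℤ
    x*[a*0]≡0 = solve-∀

  link-aligned : ∀ X {t u} → Aᶻ t u * Aᶻ t u ≡ 1ℤ → X u ≡ Aᶻ t u * X t → link X t u ≡ X t * X t
  link-aligned X {t} {u} unit aligned =
    trans (cong (λ v → X t * (Aᶻ t u * v)) aligned) (x*[a*[a*x]]≡x*x (Aᶻ t u) (X t) unit)

  row-vanishes : ∀ X xk {t} → t < M → X t ≡ 0ℤ → row X xk ⟨ t ⟩ ≡ 0ℤ
  row-vanishes X xk {t} t<M Xt≡0 = trans (row-cycle X xk t<M) (vanish Xt≡0)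
    where
    vanish : ∀ {x a b e} → x ≡ 0ℤ → + 2 * (x * x) + (x * a + x * b) + x * e ≡ 0ℤ
    vanish refl = refl

  row-interior : ∀ X xk {t} → t < M → Propagates X (prev t) → Propagates X t →
                 X t * (Aᶻᵏ t * xk) ≡ 0ℤ → row X xk ⟨ t ⟩ ≡ 0ℤ
  row-interior X xk {t} t<M into out no-k = begin
    row X xk ⟨ t ⟩
      ≡⟨ row-cycle X xk t<M ⟩
    + 2 * (X t * X t) + (link X t (next t) + link X t (prev t)) + X t * (Aᶻᵏ t * xk)
      ≡⟨ cong₂ (λ l e → + 2 * (X t * X t) + l + e)
               (cong₂ _+_ (link-next X t<M out) (link-prev X t<M into)) no-k ⟩
    + 2 * (X t * X t) + (- (X t * X t) + - (X t * X t)) + 0ℤ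
      ≡⟨ cancel (X t * X t) ⟩
    0ℤ ∎
    where
    open ≡-Reasoning
    cancel : ∀ s → + 2 * s + (- s + - s) + 0ℤ ≡ 0ℤ
    cancel = solve-∀

  row-k : ∀ X xk {p q} → p < M → q < M → p ≢ q →
          (∀ t → t < M → t ≢ p → t ≢ q → X t ≡ 0ℤ ⊎ cᶻ t ≡ 0) →
          row X xk k ≡ xk * (+ 2 * xk + Aᵏᶻ p * X p + Aᵏᶻ q * X q)
  row-k X xk {p} {q} p<M q<M p≢q elsewhere =
    trans (∑ℤ-support term (k ∷ ⟨ p ⟩ ∷ ⟨ q ⟩ ∷ []) distinct outside)
          (collect (extend-⟨⟩ X xk p<M) (extend-⟨⟩ X xk q<M) (A-diag k))
    where
    term : Fin (suc M) → ℤ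
    term j = xk * A k j * extend X xk j
    distinct : AllPairs _≢_ (k ∷ ⟨ p ⟩ ∷ ⟨ q ⟩ ∷ [])
    distinct = ((λ ()) ∷ (λ ()) ∷ []) ∷ (⟨⟩-injective p<M q<M p≢q ∷ []) ∷ [] ∷ []
    outside : ∀ i → All (i ≢_) (k ∷ ⟨ p ⟩ ∷ ⟨ q ⟩ ∷ []) → term i ≡ 0ℤ
    outside zero    (i≢k ∷ _) = contradiction refl i≢k
    outside (suc j) (_ ∷ j≢p ∷ j≢q ∷ [])
      with elsewhere (toℕ j) (FinP.toℕ<n j) (suc≢⟨⟩⇒toℕ≢ j≢p) (suc≢⟨⟩⇒toℕ≢ j≢q)
    ... | inj₁ Xj≡0 = trans (cong (λ x → xk * A k (suc j) * x) Xj≡0) (ℤP.*-zeroʳ (xk * A k (suc j)))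
    ... | inj₂ cj≡0 = trans (cong (λ a → xk * a * X (toℕ j)) Akj≡0) (x*0*y≡0 xk (X (toℕ j)))
      where
      Akj≡0 : A k (suc j) ≡ 0ℤ
      Akj≡0 = subst (λ i → A k (suc i) ≡ 0ℤ) (vertex-toℕ j) (Aᵏᶻ-unmarked {toℕ j} cj≡0)
      x*0*y≡0 : ∀ x y → x * 0ℤ * y ≡ 0ℤ
      x*0*y≡0 = solve-∀
    collect : ∀ {x x′ y y′ two} → x′ ≡ x → y′ ≡ y → two ≡ + 2 →
              xk * two * xk + (xk * Aᵏᶻ p * x′ + (xk * Aᵏᶻ q * y′ + 0ℤ))
                ≡ xk * (+ 2 * xk + Aᵏᶻ p * x + Aᵏᶻ q * y)
    collect {x} {y = y} refl refl refl = ring xk (Aᵏᶻ p) x (Aᵏᶻ q) y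
      where
      ring : ∀ z a x b y → z * + 2 * z + (z * a * x + (z * b * y + 0ℤ)) ≡ z * (+ 2 * z + a * x + b * y)
      ring = solve-∀

  ∑-cycle-rows : ∀ X xk {p q} → p < M → q < M → p ≢ q →
                 (∀ t → t < M → t ≢ p → t ≢ q → row X xk ⟨ t ⟩ ≡ 0ℤ) →
                 ∑ℤ (λ i → row X xk (suc i)) ≡ row X xk ⟨ p ⟩ + row X xk ⟨ q ⟩
  ∑-cycle-rows X xk {p} {q} p<M q<M p≢q elsewhere =
    trans (∑ℤ-support (λ i → row X xk (suc i)) (vertex p ∷ vertex q ∷ [])
                      ((p≢q ∘ vertex-injective p<M q<M ∷ []) ∷ [] ∷ []) outside)
          (cong (λ r → row X xk ⟨ p ⟩ + r) (ℤP.+-identityʳ (row X xk ⟨ q ⟩)))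
    where
    outside : ∀ i → All (i ≢_) (vertex p ∷ vertex q ∷ []) → row X xk (suc i) ≡ 0ℤ
    outside i (i≢p ∷ i≢q ∷ []) =
      subst (λ j → row X xk (suc j) ≡ 0ℤ) (vertex-toℕ i)
            (elsewhere (toℕ i) (FinP.toℕ<n i) (i≢p ∘ toℕ≡⇒≡vertex) (i≢q ∘ toℕ≡⇒≡vertex))

  τ-does-not-close : ¬ Propagates τ n
  τ-does-not-close closes = ℚP.<-irrefl (sym form≡0) (form>0 τ 0ℤ {0} (s≤s z≤n) refl)
    where
    propagates : ∀ {t} → t < M → Propagates τ t
    propagates {t} t<M with ℕP.m≤n⇒m<n∨m≡n t<M
    ... | inj₁ 1+t<M = propagates-τ τ 1+t<M refl refl
    ... | inj₂ refl  = closes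
    row≡0 : ∀ i → row τ 0ℤ i ≡ 0ℤ
    row≡0 zero    = ∑ℤ-zero _ λ j →
      trans (cong (_* extend τ 0ℤ j) (ℤP.*-zeroˡ (A k j))) (ℤP.*-zeroˡ (extend τ 0ℤ j))
    row≡0 (suc i) = subst (λ j → row τ 0ℤ (suc j) ≡ 0ℤ) (vertex-toℕ i)
      (row-interior τ 0ℤ t<M (propagates (prev<M t<M)) (propagates t<M)
                    (trans (cong (τ t *_) (ℤP.*-zeroʳ (Aᶻᵏ t))) (ℤP.*-zeroʳ (τ t))))
      where
      t = toℕ i
      t<M = FinP.toℕ<n i
    form≡0 : form τ 0ℤ ≡ 0ℚ
    form≡0 = begin
      form τ 0ℤ                                         ≡⟨ form≡rows τ 0ℤ ⟩
      d k ℚ.* ℤ→ℚ (row τ 0ℤ k) ℚ.+ δ ℚ.* ℤ→ℚ (∑ℤ (λ i → row τ 0ℤ (suc i)))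
        ≡⟨ cong₂ (λ r s → d k ℚ.* ℤ→ℚ r ℚ.+ δ ℚ.* ℤ→ℚ s) (row≡0 k) (∑ℤ-zero _ (row≡0 ∘ suc)) ⟩
      d k ℚ.* 0ℚ ℚ.+ δ ℚ.* 0ℚ                           ≡⟨ cong₂ ℚ._+_ (ℚP.*-zeroʳ (d k)) (ℚP.*-zeroʳ δ) ⟩
      0ℚ                                                ∎
      where open ≡-Reasoning

  τ-crossing-unit : Aᶻ n 0 * τ n * (Aᶻ n 0 * τ n) ≡ 1ℤ
  τ-crossing-unit = trans (regroup (Aᶻ n 0) (τ n)) (cong₂ _*_ a-unit (τ-unit ℕP.≤-refl))
    where
    a-unit : Aᶻ n 0 * Aᶻ n 0 ≡ 1ℤ
    a-unit = subst (λ u → Aᶻ n u * Aᶻ n u ≡ 1ℤ) (next-last refl) (Aᶻ-next-unit ℕP.≤-refl)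
    regroup : ∀ a x → a * x * (a * x) ≡ a * a * (x * x)
    regroup = solve-∀

  τ-crossing≡1 : Aᶻ n 0 * τ n ≡ 1ℤ
  τ-crossing≡1 with i*i≡1⇒i≡±1 (Aᶻ n 0 * τ n) τ-crossing-unit
  ... | inj₁ crossing≡1  = crossing≡1
  ... | inj₂ crossing≡-1 = contradiction closes τ-does-not-close
    where
    closes : Propagates τ n
    closes rewrite next-last {n} refl | crossing≡-1 = refl

  propagates-across : ∀ X → X n ≡ τ n → X 0 ≡ -1ℤ → Propagates X n
  propagates-across X Xn≡ X0≡ rewrite next-last {n} refl | Xn≡ | τ-crossing≡1 = X0≡

  data Ends (X : ℕ → ℤ) (p q : ℕ) : Set where
    apart       : X (prev p) ≡ 0ℤ → X (next q) ≡ 0ℤ → Ends X p q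
    -- the path is the whole cycle, and the closing edge q → p is the one edge it does not
    -- propagate along
    whole-cycle : prev p ≡ q → X p ≡ Aᶻ q p * X q →
                  (∀ t → t < M → t ≢ p → t ≢ q → cᶻ t ≡ 0) → Ends X p q

  end-weight : ∀ {X p q} → Ends X p q → ℤ
  end-weight (apart _ _)         = 1ℤ
  end-weight (whole-cycle _ _ _) = + 2

  record PathVector (X : ℕ → ℤ) (p q : ℕ) : Set where
    field
      p<M       : p < M
      q<M       : q < M
      p≢q       : p ≢ q
      marked-p  : cᶻ p ≢ 0
      marked-q  : cᶻ q ≢ 0
      unit-p    : X p * X p ≡ 1ℤ
      unit-q    : X q * X q ≡ 1ℤ
      leaves-p  : Propagates X p
      enters-q  : Propagates X (prev q)
      inside    : ∀ t → t < M → t ≢ p → t ≢ q →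
                  X t ≡ 0ℤ ⊎ (cᶻ t ≡ 0 × Propagates X (prev t) × Propagates X t)
      ends      : Ends X p q
      same-sign : sign (Aᶻᵏ q * X q) ≡ sign (Aᶻᵏ p * X p)

  module PathVectorForm {X p q} (P : PathVector X p q) where
    open PathVector P

    -- with this value at k the diagonal term at k cancels against the edge k — p
    xk : ℤ
    xk = - (Aᵏᶻ p * X p)

    w : ℤ
    w = end-weight ends

    N : ℤ
    N = Aᶻᵏ q * X q * (Aᵏᶻ p * X p)

    row-inside : ∀ t → t < M → t ≢ p → t ≢ q → row X xk ⟨ t ⟩ ≡ 0ℤ
    row-inside t t<M t≢p t≢q with inside t t<M t≢p t≢q
    ... | inj₁ Xt≡0 = row-vanishes X xk t<M Xt≡0
    ... | inj₂ (ct≡0 , into , out) = row-interior X xk t<M into out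
            (trans (cong (λ a → X t * (a * xk)) (Aᶻᵏ-unmarked {t} ct≡0)) (ℤP.*-zeroʳ (X t)))

    q-before-p : prev p ≡ q → Aᶻ p q * Aᶻ q p ≡ 1ℤ
    q-before-p prev-p≡q = subst (λ u → Aᶻ p u * Aᶻ u p ≡ 1ℤ) prev-p≡q (prev-edge p<M)

    link-before-p : link X p (prev p) ≡ w - 1ℤ
    link-before-p with ends
    ... | apart Xprev≡0 _ = link-zero X Xprev≡0
    ... | whole-cycle prev-p≡q aligned _ =
      subst (λ u → link X p u ≡ + 2 - 1ℤ) (sym prev-p≡q)
        (trans (link-aligned X (i*j≡1⇒i*i≡1 (Aᶻ p q) (Aᶻ q p) q→p) q-aligned) unit-p)
      where
      q→p = q-before-p prev-p≡q
      q-aligned : X q ≡ Aᶻ p q * X p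
      q-aligned = sym (trans (cong (Aᶻ p q *_) aligned) (a*b≡1⇒a*[b*x]≡x (Aᶻ p q) (Aᶻ q p) (X q) q→p))

    link-after-q : link X q (next q) ≡ w - 1ℤ
    link-after-q with ends
    ... | apart _ Xnext≡0 = link-zero X Xnext≡0
    ... | whole-cycle prev-p≡q aligned _ =
      subst (λ u → link X q u ≡ + 2 - 1ℤ) (sym (trans (cong next (sym prev-p≡q)) (next-prev p<M)))
        (trans (link-aligned X (i*j≡1⇒i*i≡1 (Aᶻ q p) (Aᶻ p q) p→q) aligned) unit-q)
      where
      p→q = trans (ℤP.*-comm (Aᶻ q p) (Aᶻ p q)) (q-before-p prev-p≡q)

    end-row : ∀ {t} → t < M → X t * X t ≡ 1ℤ →
              link X t (next t) + link X t (prev t) ≡ - 1ℤ + (w - 1ℤ) →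
              row X xk ⟨ t ⟩ ≡ w + X t * (Aᶻᵏ t * xk)
    end-row {t} t<M unit links = begin
      row X xk ⟨ t ⟩
        ≡⟨ row-cycle X xk t<M ⟩
      + 2 * (X t * X t) + (link X t (next t) + link X t (prev t)) + X t * (Aᶻᵏ t * xk)
        ≡⟨ cong₂ (λ s l → + 2 * s + l + X t * (Aᶻᵏ t * xk)) unit links ⟩
      + 2 * 1ℤ + (- 1ℤ + (w - 1ℤ)) + X t * (Aᶻᵏ t * xk)
        ≡⟨ simplify w (X t * (Aᶻᵏ t * xk)) ⟩
      w + X t * (Aᶻᵏ t * xk) ∎
      where
      open ≡-Reasoning
      simplify : ∀ w e → + 2 * 1ℤ + (- 1ℤ + (w - 1ℤ)) + e ≡ w + e
      simplify = solve-∀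

    row-p : row X xk ⟨ p ⟩ ≡ w + X p * (Aᶻᵏ p * xk)
    row-p = end-row p<M unit-p (cong₂ _+_ (trans (link-next X p<M leaves-p) (cong -_ unit-p)) link-before-p)

    row-q : row X xk ⟨ q ⟩ ≡ w + X q * (Aᶻᵏ q * xk)
    row-q = end-row q<M unit-q
      (trans (cong₂ _+_ link-after-q (trans (link-prev X q<M enters-q) (cong -_ unit-q)))
             (ℤP.+-comm (w - 1ℤ) (- 1ℤ)))

    r : ℤ
    r = Aᵏᶻ p * (X p * X p) - Aᵏᶻ q * X p * X q

    row-k-value : row X xk k ≡ Aᵏᶻ p * r
    row-k-value = trans (row-k X xk p<M q<M p≢q zero-or-unmarked) (factor (Aᵏᶻ p) (Aᵏᶻ q) (X p) (X q))
      where
      zero-or-unmarked : ∀ t → t < M → t ≢ p → t ≢ q → X t ≡ 0ℤ ⊎ cᶻ t ≡ 0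
      zero-or-unmarked t t<M t≢p t≢q with inside t t<M t≢p t≢q
      ... | inj₁ Xt≡0           = inj₁ Xt≡0
      ... | inj₂ (ct≡0 , _ , _) = inj₂ ct≡0
      factor : ∀ a b x y → - (a * x) * (+ 2 * - (a * x) + a * x + b * y) ≡ a * (a * (x * x) - b * x * y)
      factor = solve-∀

    rows-combine : Aᶻᵏ p * r + (row X xk ⟨ p ⟩ + row X xk ⟨ q ⟩) ≡ w + w - (N + N)
    rows-combine rewrite row-p | row-q = begin
      Aᶻᵏ p * r + (w + X p * (Aᶻᵏ p * xk) + (w + X q * (Aᶻᵏ q * xk)))
        ≡⟨ expand w (Aᶻᵏ p) (Aᵏᶻ p) (Aᶻᵏ q) (Aᵏᶻ q) (X p) (X q) ⟩
      w + w - (Aᶻᵏ p * Aᵏᶻ q * (X p * X q) + N)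
        ≡⟨ cong (λ a → w + w - (a * (X p * X q) + N)) (cross-ratio p<M q<M) ⟩
      w + w - (Aᶻᵏ q * Aᵏᶻ p * (X p * X q) + N)
        ≡⟨ cong (λ u → w + w - (u + N)) (regroup (Aᶻᵏ q) (Aᵏᶻ p) (X p) (X q)) ⟩
      w + w - (N + N) ∎
      where
      open ≡-Reasoning
      expand : ∀ w ap kp aq kq x y →
        ap * (kp * (x * x) - kq * x * y) + (w + x * (ap * - (kp * x)) + (w + y * (aq * - (kp * x))))
          ≡ w + w - (ap * kq * (x * y) + aq * y * (kp * x))
      expand = solve-∀
      regroup : ∀ a b x y → a * b * (x * y) ≡ a * y * (b * x)
      regroup = solve-∀

    form-value : form X xk ≡ δ ℚ.* ℤ→ℚ (w + w - (N + N))
    form-value = begin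
      form X xk
        ≡⟨ form≡rows X xk ⟩
      d k ℚ.* ℤ→ℚ (row X xk k) ℚ.+ δ ℚ.* ℤ→ℚ (∑ℤ (λ i → row X xk (suc i)))
        ≡⟨ cong₂ (λ a b → d k ℚ.* ℤ→ℚ a ℚ.+ δ ℚ.* ℤ→ℚ b)
                 row-k-value (∑-cycle-rows X xk p<M q<M p≢q row-inside) ⟩
      d k ℚ.* ℤ→ℚ (Aᵏᶻ p * r) ℚ.+ δ ℚ.* ℤ→ℚ (row X xk ⟨ p ⟩ + row X xk ⟨ q ⟩)
        ≡⟨ cong (ℚ._+ δ ℚ.* ℤ→ℚ (row X xk ⟨ p ⟩ + row X xk ⟨ q ⟩)) (d-k-transfer p<M r) ⟩
      δ ℚ.* ℤ→ℚ (Aᶻᵏ p * r) ℚ.+ δ ℚ.* ℤ→ℚ (row X xk ⟨ p ⟩ + row X xk ⟨ q ⟩)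
        ≡⟨ sym (ℚP.*-distribˡ-+ δ _ _) ⟩
      δ ℚ.* (ℤ→ℚ (Aᶻᵏ p * r) ℚ.+ ℤ→ℚ (row X xk ⟨ p ⟩ + row X xk ⟨ q ⟩))
        ≡⟨ cong (δ ℚ.*_) (sym (ℤ→ℚ-homo-+ (Aᶻᵏ p * r) _)) ⟩
      δ ℚ.* ℤ→ℚ (Aᶻᵏ p * r + (row X xk ⟨ p ⟩ + row X xk ⟨ q ⟩))
        ≡⟨ cong (λ a → δ ℚ.* ℤ→ℚ a) rows-combine ⟩
      δ ℚ.* ℤ→ℚ (w + w - (N + N)) ∎
      where open ≡-Reasoning

    N<w : N ℤ.< w
    N<w = 0<i+i-[j+j]⇒j<i w N
      (ℤ→ℚ-cancel-< 0ℤ _ (δ*x>0⇒x>0 _ (subst (0ℚ ℚ.<_) form-value (form>0 X xk p<M unit-p))))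

    N>0 : 0ℤ ℤ.< N
    N>0 = 0<i*j⇒0<k*j (Aᶻᵏ p * X p) (Aᵏᶻ p * X p) (Aᶻᵏ q * X q)
            (marked-positive p (X p) unit-p marked-p)
            (0<i*j⇒i≢0 (Aᶻᵏ q * X q) (Aᵏᶻ q * X q) (marked-positive q (X q) unit-q marked-q))
            same-sign

    N*N : N * N ≡ + (cᶻ q ℕ.* cᶻ p)
    N*N = begin
      N * N
        ≡⟨ regroup (Aᶻᵏ q) (Aᵏᶻ p) (X q) (X p) ⟩
      Aᶻᵏ q * Aᵏᶻ p * (Aᶻᵏ q * Aᵏᶻ p) * (X q * X q * (X p * X p))
        ≡⟨ cong (λ a → Aᶻᵏ q * Aᵏᶻ p * a * (X q * X q * (X p * X p))) (sym (cross-ratio p<M q<M)) ⟩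
      Aᶻᵏ q * Aᵏᶻ p * (Aᶻᵏ p * Aᵏᶻ q) * (X q * X q * (X p * X p))
        ≡⟨ regroup′ (Aᶻᵏ q) (Aᵏᶻ q) (Aᶻᵏ p) (Aᵏᶻ p) (X q) (X p) ⟩
      Aᶻᵏ q * X q * (Aᵏᶻ q * X q) * (Aᶻᵏ p * X p * (Aᵏᶻ p * X p))
        ≡⟨ cong₂ _*_ (marked-product q (X q) unit-q marked-q) (marked-product p (X p) unit-p marked-p) ⟩
      + cᶻ q * + cᶻ p
        ≡⟨ ℤP.pos-* (cᶻ q) (cᶻ p) ⟨ 
      + (cᶻ q ℕ.* cᶻ p) ∎
      where
      open ≡-Reasoning
      regroup : ∀ a b y x → a * y * (b * x) * (a * y * (b * x)) ≡ a * b * (a * b) * (y * y * (x * x))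
      regroup = solve-∀
      regroup′ : ∀ a b c e y x → a * e * (c * b) * (y * y * (x * x)) ≡ a * y * (b * y) * (c * x * (e * x))
      regroup′ = solve-∀

    whole-cycle-exceptional : prev p ≡ q → (∀ t → t < M → t ≢ p → t ≢ q → cᶻ t ≡ 0) → N ≡ 1ℤ →
                              Exceptional M c
    whole-cycle-exceptional prev-p≡q others N≡1 =
      vertex p , vertex q ,
      subst (λ u → Adjacent M (vertex p) (vertex u)) prev-p≡q (adjacent-prev p<M) ,
      ℕP.m*n≡1⇒n≡1 (cᶻ q) (cᶻ p) cq*cp≡1 , ℕP.m*n≡1⇒m≡1 (cᶻ q) (cᶻ p) cq*cp≡1 , rest
      where
      cq*cp≡1 : cᶻ q ℕ.* cᶻ p ≡ 1
      cq*cp≡1 = ℤP.+-injective (sym (trans (cong (λ u → u * u) (sym N≡1)) N*N))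
      rest : ∀ l → l ≢ vertex p → l ≢ vertex q → c l ≡ 0
      rest l l≢p l≢q = subst (λ i → c i ≡ 0) (vertex-toℕ l)
        (others (toℕ l) (FinP.toℕ<n l) (l≢p ∘ toℕ≡⇒≡vertex) (l≢q ∘ toℕ≡⇒≡vertex))

    exceptional : Exceptional M c
    exceptional = conclude ends N<w
      where
      conclude : (e : Ends X p q) → N ℤ.< end-weight e → Exceptional M c
      conclude (apart _ _)                     N<1 = ⊥-elim (0<i<1-impossible N>0 N<1)
      conclude (whole-cycle prev-p≡q _ others) N<2 =
        whole-cycle-exceptional prev-p≡q others (0<i<2⇒i≡1 N>0 N<2)

  σ : ℕ → Sign
  σ t = sign (Aᶻᵏ t * τ t)

  open Alternation cᶻ σ

  segment : ℕ → ℕ → ℕ → ℤ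
  segment p q t with p ℕ.≤? t | t ℕ.≤? q
  ... | yes _ | yes _ = τ t
  ... | yes _ | no _  = 0ℤ
  ... | no _  | _     = 0ℤ

  segment-inside : ∀ {p q t} → p ≤ t → t ≤ q → segment p q t ≡ τ t
  segment-inside {p} {q} {t} p≤t t≤q with p ℕ.≤? t | t ℕ.≤? q
  ... | yes _ | yes _   = refl
  ... | yes _ | no t≰q  = contradiction t≤q t≰q
  ... | no p≰t | _      = contradiction p≤t p≰t

  segment-below : ∀ {p} q {t} → t < p → segment p q t ≡ 0ℤ
  segment-below {p} q {t} t<p with p ℕ.≤? t | t ℕ.≤? q
  ... | yes p≤t | yes _ = contradiction p≤t (ℕP.<⇒≱ t<p)
  ... | yes _   | no _  = refl
  ... | no _    | _     = refl

  segment-above : ∀ p {q t} → q < t → segment p q t ≡ 0ℤ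
  segment-above p {q} {t} q<t with p ℕ.≤? t | t ℕ.≤? q
  ... | yes _ | yes t≤q = contradiction t≤q (ℕP.<⇒≱ q<t)
  ... | yes _ | no _    = refl
  ... | no _  | _       = refl

  segment-path : (e : EqualNeighbours M) →
                 PathVector (segment (EqualNeighbours.p e) (EqualNeighbours.q e))
                            (EqualNeighbours.p e) (EqualNeighbours.q e)
  segment-path e = record
    { p<M = p<M ; q<M = q<bound ; p≢q = ℕP.<⇒≢ p<q ; marked-p = marked-p ; marked-q = marked-q
    ; unit-p = trans (cong (λ x → x * x) (segment-inside ℕP.≤-refl (ℕP.<⇒≤ p<q))) (τ-unit p<M)
    ; unit-q = trans (cong (λ x → x * x) (segment-inside (ℕP.<⇒≤ p<q) ℕP.≤-refl)) (τ-unit q<bound)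
    ; leaves-p = propagates-inside ℕP.≤-refl p<q
    ; enters-q = enters p<q ℕP.≤-refl
    ; inside = inside
    ; ends = ends
    ; same-sign = subst₂ (λ x y → sign (Aᶻᵏ q * x) ≡ sign (Aᶻᵏ p * y))
                        (sym (segment-inside (ℕP.<⇒≤ p<q) ℕP.≤-refl))
                        (sym (segment-inside ℕP.≤-refl (ℕP.<⇒≤ p<q)))
                        (sym same-sign)
    }
    where
    open EqualNeighbours e
    X = segment p q
    p<M = ℕP.<-trans p<q q<bound

    propagates-inside : ∀ {s} → p ≤ s → suc s ≤ q → Propagates X s
    propagates-inside p≤s s<q = propagates-τ X (ℕP.≤-<-trans s<q q<bound)
      (segment-inside p≤s (ℕP.<⇒≤ s<q)) (segment-inside (ℕP.m≤n⇒m≤1+n p≤s) s<q)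

    enters : ∀ {u} → p < u → u ≤ q → Propagates X (prev u)
    enters {suc u} p<1+u 1+u≤q = propagates-inside (ℕP.≤-pred p<1+u) 1+u≤q

    inside : ∀ t → t < M → t ≢ p → t ≢ q →
             X t ≡ 0ℤ ⊎ (cᶻ t ≡ 0 × Propagates X (prev t) × Propagates X t)
    inside t t<M t≢p t≢q with ℕP.<-cmp t p | ℕP.<-cmp t q
    ... | tri< t<p _ _ | _              = inj₁ (segment-below q t<p)
    ... | tri≈ _ t≡p _ | _              = contradiction t≡p t≢p
    ... | tri> _ _ _   | tri≈ _ t≡q _   = contradiction t≡q t≢q
    ... | tri> _ _ _   | tri> _ _ q<t   = inj₁ (segment-above p q<t)
    ... | tri> _ _ p<t | tri< t<q _ _   =
      inj₂ (unmarked-between t p<t t<q , enters p<t (ℕP.<⇒≤ t<q) , propagates-inside (ℕP.<⇒≤ p<t) t<q)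

    before : ∀ {u} → u ≤ p → (u ≡ 0 → q ≢ n) → X (prev u) ≡ 0ℤ
    before {zero}  _   0→q≢n = segment-above p (ℕP.≤∧≢⇒< (ℕP.≤-pred q<bound) (0→q≢n refl))
    before {suc u} u<p _     = segment-below q u<p

    after-q : ¬ (p ≡ 0 × q ≡ n) → X (next q) ≡ 0ℤ
    after-q proper with ℕP.m≤n⇒m<n∨m≡n q<bound
    ... | inj₁ 1+q<M rewrite next-suc 1+q<M = segment-above p (ℕP.n<1+n q)
    ... | inj₂ last  rewrite next-last last =
      segment-below q (ℕP.n≢0⇒n>0 (λ p≡0 → proper (p≡0 , ℕP.suc-injective last)))

    ends : Ends X p q
    ends with p ℕ.≟ 0 | q ℕ.≟ n
    ... | yes refl | yes refl = whole-cycle refl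
            (trans (segment-inside {0} {n} z≤n z≤n)
                   (trans (sym τ-crossing≡1) (cong (Aᶻ n 0 *_) (sym (segment-inside {0} {n} z≤n ℕP.≤-refl)))))
            (λ t t<M t≢0 t≢n → unmarked-between t (ℕP.n≢0⇒n>0 t≢0) (ℕP.≤∧≢⇒< (ℕP.≤-pred t<M) t≢n))
    ... | no p≢0 | _      = apart (before ℕP.≤-refl (λ p≡0 → contradiction p≡0 p≢0)) (after-q (p≢0 ∘ proj₁))
    ... | _      | no q≢n = apart (before ℕP.≤-refl (λ _ → q≢n)) (after-q (q≢n ∘ proj₂))

  -- −τ below f compensates for τ not propagating along the closing edge n → 0
  wrapped : ℕ → ℕ → ℕ → ℤ
  wrapped f l t with t ℕ.≤? f | l ℕ.≤? t
  ... | yes _ | _     = - τ t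
  ... | no _  | yes _ = τ t
  ... | no _  | no _  = 0ℤ

  wrapped-low : ∀ f l {t} → t ≤ f → wrapped f l t ≡ - τ t
  wrapped-low f l {t} t≤f with t ℕ.≤? f | l ℕ.≤? t
  ... | yes _  | _ = refl
  ... | no t≰f | _ = contradiction t≤f t≰f

  wrapped-high : ∀ {f l t} → f < t → l ≤ t → wrapped f l t ≡ τ t
  wrapped-high {f} {l} {t} f<t l≤t with t ℕ.≤? f | l ℕ.≤? t
  ... | yes t≤f | _      = contradiction t≤f (ℕP.<⇒≱ f<t)
  ... | no _    | yes _  = refl
  ... | no _    | no l≰t = contradiction l≤t l≰t

  wrapped-gap : ∀ {f l t} → f < t → t < l → wrapped f l t ≡ 0ℤ
  wrapped-gap {f} {l} {t} f<t t<l with t ℕ.≤? f | l ℕ.≤? t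
  ... | yes t≤f | _      = contradiction t≤f (ℕP.<⇒≱ f<t)
  ... | no _    | yes l≤t = contradiction l≤t (ℕP.<⇒≱ t<l)
  ... | no _    | no _   = refl

  wrapped-path : (o : OppositeEnds M) →
                 PathVector (wrapped (OppositeEnds.first o) (OppositeEnds.last o))
                            (OppositeEnds.last o) (OppositeEnds.first o)
  wrapped-path o = record
    { p<M = last<bound ; q<M = f<M ; p≢q = ℕP.<⇒≢ first<last ∘ sym
    ; marked-p = marked-last ; marked-q = marked-first
    ; unit-p = trans (cong (λ x → x * x) (wrapped-high first<last ℕP.≤-refl)) (τ-unit last<bound)
    ; unit-q = trans (cong (λ x → x * x) (wrapped-low first last ℕP.≤-refl))
                     (trans (-x*-x≡x*x (τ first)) (τ-unit f<M))
    ; leaves-p = propagates-high ℕP.≤-refl last<bound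
    ; enters-q = enters-low ℕP.≤-refl
    ; inside = inside
    ; ends = ends
    ; same-sign = same-sign
    }
    where
    open OppositeEnds o
    X = wrapped first last
    f<M = ℕP.<-trans first<last last<bound

    -x*-x≡x*x : ∀ x → - x * - x ≡ x * x
    -x*-x≡x*x = solve-∀

    crosses : Propagates X n
    crosses = propagates-across X
      (wrapped-high (ℕP.<-≤-trans first<last (ℕP.≤-pred last<bound)) (ℕP.≤-pred last<bound))
      (wrapped-low first last z≤n)

    propagates-high : ∀ {s} → last ≤ s → s < M → Propagates X s
    propagates-high {s} l≤s s<M with ℕP.m≤n⇒m<n∨m≡n s<M
    ... | inj₁ 1+s<M = propagates-τ X 1+s<M (wrapped-high (ℕP.<-≤-trans first<last l≤s) l≤s)
                         (wrapped-high (ℕP.<-≤-trans first<last (ℕP.m≤n⇒m≤1+n l≤s)) (ℕP.m≤n⇒m≤1+n l≤s))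
    ... | inj₂ refl  = crosses

    propagates-low : ∀ {s} → suc s ≤ first → Propagates X s
    propagates-low 1+s≤f =
      propagates-negτ X (ℕP.≤-<-trans 1+s≤f f<M)
        (wrapped-low first last (ℕP.<⇒≤ 1+s≤f)) (wrapped-low first last 1+s≤f)

    enters-low : ∀ {u} → u ≤ first → Propagates X (prev u)
    enters-low {zero}  _     = crosses
    enters-low {suc u} 1+u≤f = propagates-low 1+u≤f

    enters-high : ∀ {u} → last < u → u < M → Propagates X (prev u)
    enters-high {suc u} l<1+u 1+u<M = propagates-high (ℕP.≤-pred l<1+u) (ℕP.<-trans (ℕP.n<1+n u) 1+u<M)

    inside : ∀ t → t < M → t ≢ last → t ≢ first →
             X t ≡ 0ℤ ⊎ (cᶻ t ≡ 0 × Propagates X (prev t) × Propagates X t)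
    inside t t<M t≢l t≢f with ℕP.<-cmp t first | ℕP.<-cmp t last
    ... | tri< t<f _ _ | _            = inj₂ (unmarked-before t t<f , enters-low (ℕP.<⇒≤ t<f) , propagates-low t<f)
    ... | tri≈ _ t≡f _ | _            = contradiction t≡f t≢f
    ... | tri> _ _ _   | tri≈ _ t≡l _ = contradiction t≡l t≢l
    ... | tri> _ _ f<t | tri< t<l _ _ = inj₁ (wrapped-gap f<t t<l)
    ... | tri> _ _ _   | tri> _ _ l<t =
      inj₂ (unmarked-after t l<t t<M , enters-high l<t t<M , propagates-high (ℕP.<⇒≤ l<t) t<M)

    before-last : ∀ {u} → first < u → u ≤ last → u ≢ suc first → X (prev u) ≡ 0ℤ
    before-last {suc u} f<1+u 1+u≤l 1+u≢1+f =
      wrapped-gap (ℕP.≤∧≢⇒< (ℕP.≤-pred f<1+u) (λ f≡u → 1+u≢1+f (cong suc (sym f≡u)))) 1+u≤l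

    after-first : last ≢ suc first → X (next first) ≡ 0ℤ
    after-first l≢1+f rewrite next-suc (ℕP.≤-<-trans first<last last<bound) =
      wrapped-gap (ℕP.n<1+n first) (ℕP.≤∧≢⇒< first<last (l≢1+f ∘ sym))

    ends : Ends X last first
    ends with last ℕ.≟ suc first
    ... | no l≢1+f  = apart (before-last first<last ℕP.≤-refl l≢1+f) (after-first l≢1+f)
    ... | yes l≡1+f = whole-cycle (cong prev l≡1+f) aligned others
      where
      open ≡-Reasoning
      aligned : X last ≡ Aᶻ first last * X first
      aligned = begin
        X last                                ≡⟨ wrapped-high first<last ℕP.≤-refl ⟩
        τ last                                ≡⟨ cong τ l≡1+f ⟩
        - (Aᶻ first (suc first) * τ first)    ≡⟨ ℤP.neg-distribʳ-* (Aᶻ first (suc first)) (τ first) ⟩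
        Aᶻ first (suc first) * - τ first
          ≡⟨ cong₂ (λ u x → Aᶻ first u * x) (sym l≡1+f) (sym (wrapped-low first last ℕP.≤-refl)) ⟩
        Aᶻ first last * X first               ∎
      others : ∀ t → t < M → t ≢ last → t ≢ first → cᶻ t ≡ 0
      others t t<M t≢l t≢f with ℕP.<-cmp t first | ℕP.<-cmp t last
      ... | tri< t<f _ _ | _            = unmarked-before t t<f
      ... | tri≈ _ t≡f _ | _            = contradiction t≡f t≢f
      ... | tri> _ _ _   | tri≈ _ t≡l _ = contradiction t≡l t≢l
      ... | tri> _ _ _   | tri> _ _ l<t = unmarked-after t l<t t<M
      ... | tri> _ _ f<t | tri< t<l _ _ = contradiction (subst (t <_) l≡1+f t<l) (ℕP.<⇒≱ (s≤s f<t))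

    same-sign : sign (Aᶻᵏ first * X first) ≡ sign (Aᶻᵏ last * X last)
    same-sign = begin
      sign (Aᶻᵏ first * X first)         ≡⟨ cong (λ x → sign (Aᶻᵏ first * x)) (wrapped-low first last ℕP.≤-refl) ⟩
      sign (Aᶻᵏ first * - τ first)       ≡⟨ cong sign (sym (ℤP.neg-distribʳ-* (Aᶻᵏ first) (τ first))) ⟩
      sign (- (Aᶻᵏ first * τ first))     ≡⟨ sign-neg (Aᶻᵏ first * τ first) σ-first≢0 ⟩
      opposite (σ first)                 ≡⟨ cong opposite opposite-signs ⟩
      opposite (opposite (σ last))       ≡⟨ SignP.opposite-involutive (σ last) ⟩
      σ last                             ≡⟨ cong (λ x → sign (Aᶻᵏ last * x)) (sym (wrapped-high first<last ℕP.≤-refl)) ⟩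
      sign (Aᶻᵏ last * X last)           ∎
      where
      open ≡-Reasoning
      σ-first≢0 : Aᶻᵏ first * τ first ≢ 0ℤ
      σ-first≢0 = 0<i*j⇒i≢0 (Aᶻᵏ first * τ first) (Aᵏᶻ first * τ first)
                    (marked-positive first (τ first) (τ-unit f<M) marked-first)

  degreeK≡marks : degreeK M c ≡ marks M
  degreeK≡marks =
    trans (∑ℕ-cong (λ i → cong (λ j → if c j ℕ.≡ᵇ 0 then 0 else 1) (sym (vertex-toℕ i))))
          (∑ℕ≡prefixSum M (λ t → if cᶻ t ℕ.≡ᵇ 0 then 0 else 1))

  even-degree⇒exceptional : ∀ h → 0 < degreeK M c → degreeK M c ≡ 2 ℕ.* h → Exceptional M c
  even-degree⇒exceptional h deg>0 even
    with equal-neighbours-or-opposite-ends M h (subst (0 <_) degreeK≡marks deg>0)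
                                                 (trans (sym degreeK≡marks) even)
  ... | inj₁ equal    = PathVectorForm.exceptional (segment-path equal)
  ... | inj₂ opposite = PathVectorForm.exceptional (wrapped-path opposite)

lemma3p6 : (m : ℕ) (h : 3 ≤ m) (c : Fin m → ℕ) →
           (∀ i → c i ≤ 2) →
           0 < degreeK m c →
           (∃ λ t → degreeK m c ≡ 2 ℕ.* t) →
           ¬ Exceptional m c →
           ¬ Positive (Γ m h c)
lemma3p6 (suc n) h c _ deg>0 (t , even) not-exceptional
         (sg , A , (A-diag , d , (d>0 , d-symmetrizes) , DA-posdef) , A-diagram) =
  not-exceptional
    (PositiveRealisation.even-degree⇒exceptional n h c A d A-diag d>0 d-symmetrizes DA-posdef sg A-diagram
       t deg>0 even)
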